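{- Let $n$ be a positive integer and let $A\in\Sigma_{n^2}$ be an $n^2\times n^2$ S-permutation matrix. Then the number $\xi_n$ of all matrices $B\in\Sigma_{n^2}$ which are disjoint with $A$ is equal to $$\xi_n=(n!)^{2n}+\sum_{k=1}^{n^2}(-1)^k\left(\sum_{\overline{g}\in\overline{\mathfrak{G}}_{n,k}}|\overline{g}|\left(\prod_{i=0}^{n-2}\left[(n-i)!\right]^{\psi_i(\overline{g})}\right)\right).$$
   Context: A binary matrix is a matrix with all entries in $\{0,1\}$. An $n^2\times n^2$ matrix is divided by $n-1$ horizontal and $n-1$ vertical lines into $n^2$ non-intersecting $n\times n$ square sub-matrices $A_{kl}$, $1\le k,l\le n$, called blocks. An $n^2\times n^2$ binary matrix is an S-permutation matrix if each row, each column and each block contains exactly one $1$; $\Sigma_{n^2}$ is the set of all $n^2\times n^2$ S-permutation matrices. Two binary matrices $A=(a_{ij})$ and $B=(b_{ij})$ of the same size are disjoint if there are no indices $i,j$ with $a_{ij}=b_{ij}=1$. For $0\le k\le n^2$, $\mathfrak{G}_{n,k}$ denotes the set of all bipartite graphs $g=\langle R_g\cup C_g,E_g\rangle$ without multiple edges on the fixed disjoint vertex sets $R_g=\{r_1,\dots,r_n\}$, $C_g=\{c_1,\dots,c_n\}$, with $E_g\subseteq R_g\times C_g$ and $|E_g|=k$. Two such graphs $g',g''$ are isomorphic, $g'\cong g''$, if there are bijections $\rho:R_{g'}\to R_{g''}$ and $\sigma:C_{g'}\to C_{g''}$ such that $\langle r,c\rangle\in E_{g'}\iff\langle\rho(r),\sigma(c)\rangle\in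 E_{g''}$ (in particular the two sides are not interchanged). $\overline{\mathfrak{G}}_{n,k}$ is the set of equivalence classes of $\mathfrak{G}_{n,k}$ under $\cong$; $\overline{g}=\{h\in\mathfrak{G}_{n,k} : h\cong g\}$ is the class of $g$ and $|\overline{g}|$ is its cardinality. For $i=0,1,\dots,n$, $\psi_i(g)$ is the number of vertices of $g$ (in $R_g\cup C_g$) incident to exactly $i$ edges; it depends only on the class, and $\psi_i(\overline{g})=\psi_i(g)$. An empty product equals $1$. -}

module Defs where

open import Data.Bool using (Bool; true; false)
import Data.Bool.Properties as Bool
open import Data.Fin using (Fin; combine)
open import Data.Fin.Properties using (_≟_; any?; all?)
open import Data.Fin.Permutation using (Permutation′; permutation; _⟨$⟩ʳ_; _⟨$⟩ˡ_; inverseˡ; inverseʳ)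
open import Data.Fin.Subset using (Subset; _∈_)
open import Data.Fin.Subset.Properties using (_∈?_)
open import Data.Integer as ℤ using (ℤ; 0ℤ)
open import Data.List
  using (List; []; _∷_; [_]; _++_; length; map; filter; foldr;
         upTo; allFin; deduplicate; cartesianProduct; cartesianProductWith)
open import Data.Nat as ℕ using (ℕ; zero; suc; _*_; _∸_; _^_; _!)
open import Data.Nat.ListAction using (sum; product)
open import Data.Product using (_×_; _,_; ∃; ∃₂; ∃!; proj₁; proj₂)
open import Data.Sum using (_⊎_; inj₁; inj₂)
open import Data.Vec using (Vec; []; _∷_; lookup; tabulate)
open import Data.Vec.Properties using (lookup∘tabulate)
open import Function using (_⇔_; mk⇔; Equivalence)
open import Relation.Binary.PropositionalEquality using (_≡_; _≗_; refl; sym; trans; cong; subst)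
open import Relation.Nullary using (Dec; ¬_)
open import Relation.Nullary.Decidable using (map′; ¬?; _×-dec_; _→-dec_)
open import Relation.Unary using (Decidable)

-- All vectors of length n with entries in xs, without repetitions if xs has none. Every
-- cardinality below is the length of a repetition-free enumeration filtered by a property.
vectors : {A : Set} → List A → (n : ℕ) → List (Vec A n)
vectors xs zero    = [ [] ]
vectors xs (suc n) = cartesianProductWith _∷_ xs (vectors xs n)

bits : List Bool
bits = false ∷ true ∷ []

-- Binary matrices, with true for 1 and false for 0.

BinaryMatrix : ℕ → ℕ → Set
BinaryMatrix m n = Vec (Vec Bool n) m

binaryMatrices : (m n : ℕ) → List (BinaryMatrix m n)
binaryMatrices m n = vectors (vectors bits n) m

entry : ∀ {m n} → BinaryMatrix m n → Fin m → Fin n → Bool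
entry A i j = lookup (lookup A i) j

-- combine k i is the index n·k + i (everything counted from 0).
block : ∀ {n} → BinaryMatrix (n * n) (n * n) → Fin n → Fin n → BinaryMatrix n n
block A k l = tabulate λ i → tabulate λ j → entry A (combine k i) (combine l j)

record IsSPermutation (n : ℕ) (A : BinaryMatrix (n * n) (n * n)) : Set where
  field
    row    : ∀ i → ∃! _≡_ λ j → entry A i j ≡ true
    column : ∀ j → ∃! _≡_ λ i → entry A i j ≡ true
    blocks : ∀ k l → ∃! _≡_ λ ((i , j) : Fin n × Fin n) → entry (block A k l) i j ≡ true

Disjoint : ∀ {m n} → BinaryMatrix m n → BinaryMatrix m n → Set
Disjoint A B = ¬ ∃₂ λ i j → entry A i j ≡ true × entry B i j ≡ true

∃!-dec : ∀ {n} {P : Fin n → Set} → Decidable P → Dec (∃! _≡_ P)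
∃!-dec P? = any? λ x →
  P? x ×-dec map′ (λ f {y} → f y) (λ f y → f {y}) (all? λ y → P? y →-dec (x ≟ y))

∃!₂-dec : ∀ {m n} {P : Fin m × Fin n → Set} → Decidable P → Dec (∃! _≡_ P)
∃!₂-dec {m} {n} {P} P? = map′ to from
  (any? λ i → any? λ j → P? (i , j) ×-dec
    all? λ i′ → all? λ j′ → P? (i′ , j′) →-dec (i ≟ i′) ×-dec (j ≟ j′))
  where
  Unique₂ : Set
  Unique₂ = ∃₂ λ i j → P (i , j) × (∀ i′ j′ → P (i′ , j′) → i ≡ i′ × j ≡ j′)

  to : Unique₂ → ∃! _≡_ P
  to (i , j , p , u) = (i , j) , p , λ {y} q → pair (u (proj₁ y) (proj₂ y) q)
    where
    pair : ∀ {i j} {y : Fin m × Fin n} → i ≡ proj₁ y × j ≡ proj₂ y → (i , j) ≡ y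
    pair (refl , refl) = refl

  from : ∃! _≡_ P → Unique₂
  from ((i , j) , p , u) = i , j , p , λ i′ j′ q → cong proj₁ (u q) , cong proj₂ (u q)

isSPermutation? : ∀ n → Decidable (IsSPermutation n)
isSPermutation? n A = map′
  (λ (r , c , b) → record { row = r ; column = c ; blocks = b })
  (λ s → let open IsSPermutation s in row , column , blocks)
  (     (all? λ i → ∃!-dec λ j → entry A i j Bool.≟ true)
  ×-dec (all? λ j → ∃!-dec λ i → entry A i j Bool.≟ true)
  ×-dec (all? λ k → all? λ l → ∃!₂-dec λ (i , j) → entry (block A k l) i j Bool.≟ true))

disjoint? : ∀ {m n} (A : BinaryMatrix m n) → Decidable (Disjoint A)
disjoint? A B =
  ¬? (any? λ i → any? λ j → (entry A i j Bool.≟ true) ×-dec (entry B i j Bool.≟ true))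

sPermutationMatrices : (n : ℕ) → List (BinaryMatrix (n * n) (n * n))
sPermutationMatrices n = filter (isSPermutation? n) (binaryMatrices (n * n) (n * n))

ξ : (n : ℕ) → BinaryMatrix (n * n) (n * n) → ℕ
ξ n A = length (filter (disjoint? A) (sPermutationMatrices n))

-- A bipartite graph on {r₁,…,rₙ} and {c₁,…,cₙ}: the i-th component is the set of
-- neighbours of rᵢ.
Graph : ℕ → Set
Graph n = Vec (Subset n) n

Edge : ∀ {n} → Graph n → Fin n × Fin n → Set
Edge g (r , c) = c ∈ lookup g r

edge? : ∀ {n} (g : Graph n) → Decidable (Edge g)
edge? g (r , c) = c ∈? lookup g r

edges : ∀ {n} → Graph n → List (Fin n × Fin n)
edges {n} g = filter (edge? g) (cartesianProduct (allFin n) (allFin n))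

graphs : (n k : ℕ) → List (Graph n)
graphs n k = filter (λ g → length (edges g) ℕ.≟ k) (vectors (vectors bits n) n)

Vertex : ℕ → Set
Vertex n = Fin n ⊎ Fin n

vertices : (n : ℕ) → List (Vertex n)
vertices n = map inj₁ (allFin n) ++ map inj₂ (allFin n)

Incident : ∀ {n} → Vertex n → Fin n × Fin n → Set
Incident (inj₁ r) e = r ≡ proj₁ e
Incident (inj₂ c) e = c ≡ proj₂ e

incident? : ∀ {n} (v : Vertex n) → Decidable (Incident v)
incident? (inj₁ r) e = r ≟ proj₁ e
incident? (inj₂ c) e = c ≟ proj₂ e

degree : ∀ {n} → Graph n → Vertex n → ℕ
degree g v = length (filter (incident? v) (edges g))

ψ : ∀ {n} → ℕ → Graph n → ℕ
ψ {n} i g = length (filter (λ v → degree g v ℕ.≟ i) (vertices n))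

infix 4 _≅_ _≅?_

_≅_ : ∀ {n} → Graph n → Graph n → Set
_≅_ {n} g h = ∃₂ λ (ρ σ : Permutation′ n) →
  ∀ r c → Edge g (r , c) ⇔ Edge h (ρ ⟨$⟩ʳ r , σ ⟨$⟩ʳ c)

anyVec? : ∀ {m n} {P : Vec (Fin m) n → Set} → Decidable P → Dec (∃ P)
anyVec? {n = zero}  P? = map′ ([] ,_) (λ { ([] , p) → p }) (P? [])
anyVec? {n = suc n} P? = map′
  (λ (x , xs , p) → x ∷ xs , p)
  (λ { (x ∷ xs , p) → x , xs , p })
  (any? λ x → anyVec? λ xs → P? (x ∷ xs))

anyPermutation? : ∀ {n} {P : (Fin n → Fin n) → Set} →
  (∀ {f g} → f ≗ g → P f → P g) → Decidable P →
  Dec (∃ λ (π : Permutation′ n) → P (π ⟨$⟩ʳ_))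
anyPermutation? {n} {P} resp P? = map′ to from
  (anyVec? λ v → anyVec? λ w →
    (all? λ i → lookup v (lookup w i) ≟ i) ×-dec
    (all? λ i → lookup w (lookup v i) ≟ i) ×-dec
    P? (lookup v))
  where
  Inverses : Set
  Inverses = ∃₂ λ (v w : Vec (Fin n) n) →
    (∀ i → lookup v (lookup w i) ≡ i) × (∀ i → lookup w (lookup v i) ≡ i) × P (lookup v)

  to : Inverses → ∃ λ (π : Permutation′ n) → P (π ⟨$⟩ʳ_)
  to (v , w , vw , wv , p) = permutation (lookup v) (lookup w) vw wv , p

  from : (∃ λ (π : Permutation′ n) → P (π ⟨$⟩ʳ_)) → Inverses
  from (π , p) = tabulate (π ⟨$⟩ʳ_) , tabulate (π ⟨$⟩ˡ_)
    , (λ i → trans (lookup∘tabulate (π ⟨$⟩ʳ_) _)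
               (trans (cong (π ⟨$⟩ʳ_) (lookup∘tabulate (π ⟨$⟩ˡ_) i)) (inverseʳ π)))
    , (λ i → trans (lookup∘tabulate (π ⟨$⟩ˡ_) _)
               (trans (cong (π ⟨$⟩ˡ_) (lookup∘tabulate (π ⟨$⟩ʳ_) i)) (inverseˡ π)))
    , resp (λ i → sym (lookup∘tabulate (π ⟨$⟩ʳ_) i)) p

_⇔-dec_ : {A B : Set} → Dec A → Dec B → Dec (A ⇔ B)
a? ⇔-dec b? = map′ (λ (f , g) → mk⇔ f g) (λ e → Equivalence.to e , Equivalence.from e)
  ((a? →-dec b?) ×-dec (b? →-dec a?))

_≅?_ : ∀ {n} (g h : Graph n) → Dec (g ≅ h)
_≅?_ {n} g h =
  anyPermutation? (λ { p≗q (σ , e) → σ , λ r c → subst (Preserves r c (σ ⟨$⟩ʳ c)) (p≗q r) (e r c) }) λ p →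
  anyPermutation? (λ q≗s e r c → subst (λ c′ → Preserves r c c′ (p r)) (q≗s c) (e r c)) λ q →
  all? λ r → all? λ c → edge? g (r , c) ⇔-dec edge? h (p r , q c)
  where
  Preserves : (r c c′ r′ : Fin n) → Set
  Preserves r c c′ r′ = Edge g (r , c) ⇔ Edge h (r′ , c′)

isoClass : ∀ {n} → ℕ → Graph n → List (Graph n)
isoClass {n} k g = filter (_≅? g) (graphs n k)

-- The quotient of graphs n k by _≅_, each class being given by its first member in
-- the enumeration. Functions on classes, such as ψ i, are evaluated at this member.
classes : (n k : ℕ) → List (Graph n)
classes n k = deduplicate _≅?_ (graphs n k)

sumℤ : List ℤ → ℤ
sumℤ = foldr ℤ._+_ 0ℤ

-- upTo (n ∸ 1) is 0, …, n − 2, which is empty for n = 1.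
classTerm : (n k : ℕ) → Graph n → ℕ
classTerm n k g =
  length (isoClass k g) * product (map (λ i → ((n ∸ i) !) ^ ψ i g) (upTo (n ∸ 1)))

classSum : (n k : ℕ) → ℕ
classSum n k = sum (map (classTerm n k) (classes n k))

{-# OPTIONS --safe #-}
-- An S-permutation matrix B is the same thing as two n-tuples of permutations ρ, σ of
-- {1,…,n}: the 1 of the block B_kl sits in its row ρ_k(l) and its column σ_l(k). If A is given
-- by (α , β), then A and B are disjoint iff no pair (k , l) has both α_k(l) = ρ_k(l) and
-- β_l(k) = σ_l(k). Expanding the product over (k , l) of 1 − [α_k(l) = ρ_k(l)] [β_l(k) = σ_l(k)]
-- gives a signed sum over the graphs g on the pairs (k , l). For fixed g the number of (ρ , σ)
-- agreeing with (α , β) on the edges of g factors over the vertices, a vertex of degree d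
-- contributing (n − d)! completions of a partial permutation. As 0! = 1! = 1, only the degrees
-- up to n − 2 matter. The product depends on g only up to isomorphism, so the graphs with k
-- edges are grouped into classes, and k = 0 gives the leading term.
module Submission where

open import Defs
open import Algebra.Bundles using (CommutativeMonoid)
import Algebra.Properties.CommutativeMonoid.Sum as FinSum
import Algebra.Properties.CommutativeSemigroup as CommutativeSemigroupProperties
open import Algebra.Structures using (IsCommutativeMonoid)
open import Data.Bool using (Bool; true; false; if_then_else_)
import Data.Bool.Properties as Bool
open import Data.Fin using (Fin; zero; suc; combine; remQuot; punchOut)
open import Data.Fin.Permutation as Perm using (_⟨$⟩ʳ_; _⟨$⟩ˡ_; inverseʳ)
open import Data.Fin.Properties
  using (_≟_; any?; all?; suc-injective; combine-surjective; combine-injective; remQuot-combine;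
         punchOut-injective; injective⇒≤)
open import Data.Fin.Subset using (Subset; ∣_∣)
open import Data.Fin.Subset.Properties using (∣p∣≤n)
open import Data.Integer as ℤ using (ℤ; 0ℤ; 1ℤ; -1ℤ; +_)
import Data.Integer.Properties as ℤ
open import Data.List
  using (List; []; _∷_; _++_; length; map; filter; foldr; upTo; allFin; deduplicate;
         cartesianProduct; cartesianProductWith)
import Data.List as List
open import Data.List.Membership.Propositional using (_∈_)
open import Data.List.Membership.Propositional.Properties
  using (∈-allFin; ∈-cartesianProduct⁺; ∈-cartesianProductWith⁺; ∈-cartesianProductWith⁻;
         ∈-filter⁺; ∈-filter⁻; ∈-upTo⁺; ∈-upTo⁻)
open import Data.List.Membership.Propositional.Properties.WithK using (unique∧set⇒bag)
open import Data.List.Properties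
  using (filter-none; length-++; length-filter; length-map; length-tabulate; map-tabulate;
         map-upTo; map-∘)
open import Data.List.Relation.Binary.BagAndSetEquality using (∼bag⇒↭)
open import Data.List.Relation.Binary.Permutation.Propositional using (_↭_; ↭⇒↭ₛ)
open import Data.List.Relation.Binary.Permutation.Propositional.Properties using (map⁺)
import Data.List.Relation.Binary.Permutation.Setoid.Properties as Permutationₛ
open import Data.List.Relation.Unary.All as All using ([]; _∷_)
open import Data.List.Relation.Unary.AllPairs using ([]; _∷_)
open import Data.List.Relation.Unary.Any using (here; there)
open import Data.List.Relation.Unary.Unique.Propositional using (Unique)
open import Data.List.Relation.Unary.Unique.Propositional.Properties
  using (allFin⁺; cartesianProductWith⁺; filter⁺; upTo⁺)
open import Data.Nat as ℕ using (ℕ; NonZero; zero; suc; _*_; _∸_; _^_; _!; _<_; _≤_; z≤n; s≤s)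
open import Data.Nat.ListAction using (product)
import Data.Nat.Properties as ℕ
open import Data.Product using (_×_; _,_; proj₁; proj₂; ∃; ∃!)
open import Data.Sum using (inj₁; inj₂)
open import Data.Vec as Vec using (Vec; []; _∷_; lookup; tabulate; replicate)
open import Data.Vec.Properties
  using (∷-injective; []=⇒lookup; lookup-map; lookup-replicate; lookup⇒[]=; lookup∘tabulate;
         tabulate-cong; tabulate∘lookup)
import Data.Vec.Relation.Unary.All as Allᵥ
import Data.Vec.Relation.Unary.AllPairs as AllPairsᵥ
import Data.Vec.Relation.Unary.Unique.Propositional as Uniqueᵥ
import Data.Vec.Relation.Unary.Unique.Propositional.Properties as Uniqueᵥ
open import Function using (_∘_; id; mk⇔; Equivalence)
open import Relation.Binary using (DecidableEquality)
open import Relation.Binary.PropositionalEquality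
open import Relation.Nullary using (Dec; yes; no; ¬_; does; contradiction)
open import Relation.Nullary.Decidable using (¬?; _×-dec_; dec-true)
open import Relation.Unary using (Decidable)

open import Algebra.Properties.AbelianGroup ℤ.+-0-abelianGroup
  using () renaming (∙-cancelʳ to +-cancelʳ)
open import Algebra.Properties.CommutativeSemigroup ℤ.*-commutativeSemigroup
  using () renaming (x∙yz≈y∙xz to x*[y*z]≡y*[x*z])
open Equivalence using () renaming (to to forward; from to backward)
open ≡-Reasoning

-- Iterated operations

module BigOp {A : Set} {_∙_ : A → A → A} {ε : A} (isCM : IsCommutativeMonoid _≡_ _∙_ ε) where
  open IsCommutativeMonoid isCM using (assoc; comm; identityˡ; identityʳ)

  commutativeMonoid : CommutativeMonoid _ _
  commutativeMonoid = record { isCommutativeMonoid = isCM }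

  open CommutativeSemigroupProperties (CommutativeMonoid.commutativeSemigroup commutativeMonoid)
    using (interchange)
  open FinSum commutativeMonoid public
    using () renaming
    ( sum to bigFin; sum-cong-≗ to bigFin-cong; sum-permute to bigFin-permute
    ; ∑-comm to bigFin-comm; ∑-distrib-+ to bigFin-∙ )

  -- The form `foldr` after `map` makes the sums and products below coincide by computation with the
  -- `sumℤ`, `sum` and `product` of the formula.
  big : {X : Set} → List X → (X → A) → A
  big xs f = foldr _∙_ ε (map f xs)

  big-cong-∈ : {X : Set} (xs : List X) {f g : X → A} →
    (∀ {x} → x ∈ xs → f x ≡ g x) → big xs f ≡ big xs g
  big-cong-∈ []       eq = refl
  big-cong-∈ (x ∷ xs) eq = cong₂ _∙_ (eq (here refl)) (big-cong-∈ xs (eq ∘ there))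

  big-cong : {X : Set} (xs : List X) {f g : X → A} → f ≗ g → big xs f ≡ big xs g
  big-cong xs eq = big-cong-∈ xs (λ {x} _ → eq x)

  big-ε : {X : Set} (xs : List X) {f : X → A} → (∀ {x} → x ∈ xs → f x ≡ ε) → big xs f ≡ ε
  big-ε []       eq = refl
  big-ε (x ∷ xs) eq = trans (cong₂ _∙_ (eq (here refl)) (big-ε xs (eq ∘ there))) (identityˡ ε)

  big-map : {X Y : Set} (h : X → Y) (xs : List X) (f : Y → A) → big (map h xs) f ≡ big xs (f ∘ h)
  big-map h xs f = cong (foldr _∙_ ε) (sym (map-∘ xs))

  big-++ : {X : Set} (xs ys : List X) (f : X → A) → big (xs ++ ys) f ≡ big xs f ∙ big ys f
  big-++ []       ys f = sym (identityˡ _)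
  big-++ (x ∷ xs) ys f = trans (cong (f x ∙_) (big-++ xs ys f)) (sym (assoc _ _ _))

  big-∙ : {X : Set} (xs : List X) (f g : X → A) → big xs (λ x → f x ∙ g x) ≡ big xs f ∙ big xs g
  big-∙ []       f g = sym (identityˡ ε)
  big-∙ (x ∷ xs) f g = trans (cong ((f x ∙ g x) ∙_) (big-∙ xs f g)) (interchange _ _ _ _)

  big-comm : {X Y : Set} (xs : List X) (ys : List Y) (f : X → Y → A) →
    big xs (λ x → big ys (f x)) ≡ big ys (λ y → big xs (λ x → f x y))
  big-comm []       ys f = sym (big-ε ys (λ _ → refl))
  big-comm (x ∷ xs) ys f = trans (cong (big ys (f x) ∙_) (big-comm xs ys f)) (sym (big-∙ ys (f x) _))

  big-cartesianProductWith : {X Y Z : Set} (h : X → Y → Z) (xs : List X) (ys : List Y) (f : Z → A) →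
    big (cartesianProductWith h xs ys) f ≡ big xs (λ x → big ys (λ y → f (h x y)))
  big-cartesianProductWith h []       ys f = refl
  big-cartesianProductWith h (x ∷ xs) ys f =
    trans (big-++ (map (h x) ys) _ f)
      (cong₂ _∙_ (big-map (h x) ys f) (big-cartesianProductWith h xs ys f))

  big-only : {X : Set} {xs : List X} {x : X} {f : X → A} → Unique xs → x ∈ xs →
    (∀ {y} → y ∈ xs → x ≢ y → f y ≡ ε) → big xs f ≡ f x
  big-only {xs = x ∷ xs} {f = f} (x≢xs ∷ _) (here refl) eq =
    trans (cong (f x ∙_) (big-ε xs (λ y∈xs → eq (there y∈xs) (All.lookup x≢xs y∈xs)))) (identityʳ _)
  big-only {xs = z ∷ xs} {f = f} (z≢xs ∷ u) (there x∈xs) eq =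
    trans (cong₂ _∙_ (eq (here refl) (≢-sym (All.lookup z≢xs x∈xs))) (big-only u x∈xs (eq ∘ there)))
      (identityˡ _)

  big-filter : {X : Set} {P : X → Set} (P? : Decidable P) (xs : List X) (f : X → A) →
    big (filter P? xs) f ≡ big xs (λ x → if does (P? x) then f x else ε)
  big-filter P? []       f = refl
  big-filter P? (x ∷ xs) f with does (P? x)
  ... | true  = cong (f x ∙_) (big-filter P? xs f)
  ... | false = trans (big-filter P? xs f) (sym (identityˡ _))

  big-allFin : ∀ {n} (f : Fin n → A) → big (allFin n) f ≡ bigFin f
  big-allFin f = trans (cong (foldr _∙_ ε) (map-tabulate id f)) (go f)
    where
    go : ∀ {n} (f : Fin n → A) → foldr _∙_ ε (List.tabulate f) ≡ bigFin f
    go {zero}  f = refl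
    go {suc n} f = cong (f zero ∙_) (go (f ∘ suc))

  big-↭ : {X : Set} {xs ys : List X} (f : X → A) → xs ↭ ys → big xs f ≡ big ys f
  big-↭ f p = Permutationₛ.foldr-commMonoid (setoid A) isCM (↭⇒↭ₛ (map⁺ f p))

module Sum = BigOp ℤ.+-0-isCommutativeMonoid
module Prod = BigOp ℤ.*-1-isCommutativeMonoid

∑ : {X : Set} → List X → (X → ℤ) → ℤ
∑ = Sum.big

∏ : ∀ {n} → (Fin n → ℤ) → ℤ
∏ = Prod.bigFin

-- In a list without repetitions an element has only one proof of membership, so equality as sets is
-- already equality as bags.
unique-↭ : {X : Set} {xs ys : List X} → Unique xs → Unique ys →
  (∀ {x} → x ∈ xs → x ∈ ys) → (∀ {x} → x ∈ ys → x ∈ xs) → xs ↭ ys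
unique-↭ u v to from = ∼bag⇒↭ (unique∧set⇒bag u v (mk⇔ to from))

∏-zero : ∀ {n} {f : Fin n → ℤ} (i : Fin n) → f i ≡ 0ℤ → ∏ f ≡ 0ℤ
∏-zero {f = f} zero    eq = trans (cong (ℤ._* ∏ (f ∘ suc)) eq) (ℤ.*-zeroˡ (∏ (f ∘ suc)))
∏-zero {f = f} (suc i) eq = trans (cong (f zero ℤ.*_) (∏-zero i eq)) (ℤ.*-zeroʳ (f zero))

∑-*ˡ : {X : Set} (xs : List X) (c : ℤ) (f : X → ℤ) → ∑ xs (λ x → c ℤ.* f x) ≡ c ℤ.* ∑ xs f
∑-*ˡ []       c f = sym (ℤ.*-zeroʳ c)
∑-*ˡ (x ∷ xs) c f = trans (cong (ℤ._+_ (c ℤ.* f x)) (∑-*ˡ xs c f)) (sym (ℤ.*-distribˡ-+ c _ _))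

∑-*ʳ : {X : Set} (xs : List X) (c : ℤ) (f : X → ℤ) → ∑ xs (λ x → f x ℤ.* c) ≡ ∑ xs f ℤ.* c
∑-*ʳ []       c f = sym (ℤ.*-zeroˡ c)
∑-*ʳ (x ∷ xs) c f = trans (cong (ℤ._+_ (f x ℤ.* c)) (∑-*ʳ xs c f)) (sym (ℤ.*-distribʳ-+ c (f x) _))

+length : {X : Set} (xs : List X) → + length xs ≡ ∑ xs (λ _ → 1ℤ)
+length []       = refl
+length (x ∷ xs) = cong (ℤ._+_ 1ℤ) (+length xs)

+sum : {X : Set} (xs : List X) (f : X → ℕ) → + foldr ℕ._+_ 0 (map f xs) ≡ ∑ xs (λ x → + f x)
+sum []       f = refl
+sum (x ∷ xs) f = cong (ℤ._+_ (+ f x)) (+sum xs f)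

-- Iverson brackets and counting

⟦_⟧ : {P : Set} → Dec P → ℤ
⟦ d ⟧ = if does d then 1ℤ else 0ℤ

⟦⟧-true : {P : Set} (d : Dec P) → P → ⟦ d ⟧ ≡ 1ℤ
⟦⟧-true (yes _) _ = refl
⟦⟧-true (no ¬p) p = contradiction p ¬p

⟦⟧-false : {P : Set} (d : Dec P) → ¬ P → ⟦ d ⟧ ≡ 0ℤ
⟦⟧-false (yes p) ¬p = contradiction p ¬p
⟦⟧-false (no _)  _  = refl

⟦⟧-cong : {P Q : Set} (d : Dec P) (e : Dec Q) → (P → Q) → (Q → P) → ⟦ d ⟧ ≡ ⟦ e ⟧
⟦⟧-cong (yes p) e to from = sym (⟦⟧-true e (to p))
⟦⟧-cong (no ¬p) e to from = sym (⟦⟧-false e (¬p ∘ from))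

⟦⟧-× : {P Q : Set} (d : Dec P) (e : Dec Q) → ⟦ d ×-dec e ⟧ ≡ ⟦ d ⟧ ℤ.* ⟦ e ⟧
⟦⟧-× (yes _) e = sym (ℤ.*-identityˡ _)
⟦⟧-× (no _)  e = refl

⟦⟧-¬ : {P : Set} (d : Dec P) → ⟦ ¬? d ⟧ ≡ 1ℤ ℤ.+ -1ℤ ℤ.* ⟦ d ⟧
⟦⟧-¬ (yes _) = refl
⟦⟧-¬ (no _)  = refl

∑-filter : {X : Set} {P : X → Set} (P? : Decidable P) (xs : List X) (f : X → ℤ) →
  ∑ (filter P? xs) f ≡ ∑ xs (λ x → ⟦ P? x ⟧ ℤ.* f x)
∑-filter P? xs f = trans (Sum.big-filter P? xs f) (Sum.big-cong xs λ x → choose (does (P? x)) (f x))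
  where
  choose : ∀ b z → (if b then z else 0ℤ) ≡ (if b then 1ℤ else 0ℤ) ℤ.* z
  choose true  z = sym (ℤ.*-identityˡ z)
  choose false z = refl

+length-filter : {X : Set} {P : X → Set} (P? : Decidable P) (xs : List X) →
  + length (filter P? xs) ≡ ∑ xs (λ x → ⟦ P? x ⟧)
+length-filter P? xs = begin
  + length (filter P? xs)          ≡⟨ +length (filter P? xs) ⟩
  ∑ (filter P? xs) (λ _ → 1ℤ)      ≡⟨ ∑-filter P? xs _ ⟩
  ∑ xs (λ x → ⟦ P? x ⟧ ℤ.* 1ℤ)     ≡⟨ Sum.big-cong xs (λ x → ℤ.*-identityʳ ⟦ P? x ⟧) ⟩
  ∑ xs (λ x → ⟦ P? x ⟧)            ∎

∑-delta : {X : Set} {xs : List X} {x : X} (x≟ : (y : X) → Dec (x ≡ y)) (f : X → ℤ) →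
  Unique xs → x ∈ xs → ∑ xs (λ y → ⟦ x≟ y ⟧ ℤ.* f y) ≡ f x
∑-delta {x = x} x≟ f u x∈xs = trans
  (Sum.big-only u x∈xs (λ {y} _ x≢y → cong (ℤ._* f y) (⟦⟧-false (x≟ y) x≢y)))
  (trans (cong (ℤ._* f x) (⟦⟧-true (x≟ x) refl)) (ℤ.*-identityˡ (f x)))

-- After exchange of the sums, each x keeps a single nonzero term, at k = h x, and the bound ensures
-- that this k occurs. Applied with the number of edges as h.
∑-fibres : {X : Set} (xs : List X) (h : X → ℕ) (N : ℕ) (f : X → ℤ) → (∀ x → h x < N) →
  ∑ xs f ≡ ∑ (upTo N) (λ k → ∑ (filter (λ x → h x ℕ.≟ k) xs) f)
∑-fibres xs h N f h<N = sym (begin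
  ∑ (upTo N) (λ k → ∑ (filter (λ x → h x ℕ.≟ k) xs) f)
    ≡⟨ Sum.big-cong (upTo N) (λ k → ∑-filter (λ x → h x ℕ.≟ k) xs f) ⟩
  ∑ (upTo N) (λ k → ∑ xs (λ x → ⟦ h x ℕ.≟ k ⟧ ℤ.* f x))
    ≡⟨ Sum.big-comm (upTo N) xs _ ⟩
  ∑ xs (λ x → ∑ (upTo N) (λ k → ⟦ h x ℕ.≟ k ⟧ ℤ.* f x))
    ≡⟨ Sum.big-cong xs (λ x → ∑-delta (h x ℕ.≟_) (λ _ → f x) (upTo⁺ N) (∈-upTo⁺ (h<N x))) ⟩
  ∑ xs f ∎)

-- Sums over equivalence classes and over vectors

module _ {X : Set} {_∼_ : X → X → Set} (_∼?_ : ∀ x y → Dec (x ∼ y))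
  (∼-refl : ∀ {x} → x ∼ x) (∼-sym : ∀ {x y} → x ∼ y → y ∼ x)
  (∼-trans : ∀ {x y z} → x ∼ y → y ∼ z → x ∼ z) where

  -- Induction along `deduplicate`, which keeps the head z and drops from the deduplicated tail
  -- whatever is related to z. If x ∼ z, nothing that survives is related to x. Otherwise only
  -- elements unrelated to x are dropped, and x lies in the tail.
  representative-unique : ∀ {x} (xs : List X) → x ∈ xs →
    ∑ (deduplicate _∼?_ xs) (λ y → ⟦ x ∼? y ⟧) ≡ 1ℤ
  representative-unique {x} (z ∷ xs) x∈ = begin
    ⟦ x ∼? z ⟧ ℤ.+ ∑ (filter (λ y → ¬? (z ∼? y)) ys) (λ y → ⟦ x ∼? y ⟧)
      ≡⟨ cong (ℤ._+_ ⟦ x ∼? z ⟧) (∑-filter (λ y → ¬? (z ∼? y)) ys _) ⟩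
    ⟦ x ∼? z ⟧ ℤ.+ ∑ ys (λ y → ⟦ ¬? (z ∼? y) ⟧ ℤ.* ⟦ x ∼? y ⟧)
      ≡⟨ rest x∈ (x ∼? z) ⟩
    1ℤ ∎
    where
    ys = deduplicate _∼?_ xs
    step : ∀ {y} → ¬ (x ∼ z) → ⟦ ¬? (z ∼? y) ⟧ ℤ.* ⟦ x ∼? y ⟧ ≡ ⟦ x ∼? y ⟧
    step {y} x≁z with z ∼? y
    ... | yes z∼y = sym (⟦⟧-false (x ∼? y) (λ x∼y → x≁z (∼-trans x∼y (∼-sym z∼y))))
    ... | no _    = ℤ.*-identityˡ _
    rest : x ∈ z ∷ xs → (d : Dec (x ∼ z)) →
      ⟦ d ⟧ ℤ.+ ∑ ys (λ y → ⟦ ¬? (z ∼? y) ⟧ ℤ.* ⟦ x ∼? y ⟧) ≡ 1ℤ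
    rest _ (yes x∼z) = cong (ℤ._+_ 1ℤ) (Sum.big-ε ys vanish)
      where
      vanish : ∀ {y} → y ∈ ys → ⟦ ¬? (z ∼? y) ⟧ ℤ.* ⟦ x ∼? y ⟧ ≡ 0ℤ
      vanish {y} _ with z ∼? y
      ... | yes _   = refl
      ... | no z≁y  = trans (ℤ.*-identityˡ _) (⟦⟧-false (x ∼? y) (z≁y ∘ ∼-trans (∼-sym x∼z)))
    rest (here refl)  (no x≁z) = contradiction ∼-refl x≁z
    rest (there x∈xs) (no x≁z) = trans (ℤ.+-identityˡ _)
      (trans (Sum.big-cong ys (λ _ → step x≁z)) (representative-unique xs x∈xs))

  -- Each f x is multiplied by 1, written as the number of representatives related to x. Exchanging
  -- the sums then collects the members of a class at its representative y, where f x may be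
  -- replaced by f y.
  ∑-deduplicate : (xs : List X) (f : X → ℤ) → (∀ {x y} → x ∼ y → f x ≡ f y) →
    ∑ xs f ≡ ∑ (deduplicate _∼?_ xs) (λ y → + length (filter (_∼? y) xs) ℤ.* f y)
  ∑-deduplicate xs f f-resp = begin
    ∑ xs f
      ≡⟨ Sum.big-cong-∈ xs (λ {x} x∈xs → sym
           (trans (cong (ℤ._* f x) (representative-unique xs x∈xs)) (ℤ.*-identityˡ (f x)))) ⟩
    ∑ xs (λ x → ∑ ys (λ y → ⟦ x ∼? y ⟧) ℤ.* f x)
      ≡⟨ Sum.big-cong xs (λ x → sym (∑-*ʳ ys (f x) _)) ⟩
    ∑ xs (λ x → ∑ ys (λ y → ⟦ x ∼? y ⟧ ℤ.* f x))
      ≡⟨ Sum.big-comm xs ys _ ⟩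
    ∑ ys (λ y → ∑ xs (λ x → ⟦ x ∼? y ⟧ ℤ.* f x))
      ≡⟨ Sum.big-cong ys (λ y → trans (Sum.big-cong xs (λ x → move x y)) (∑-*ʳ xs (f y) _)) ⟩
    ∑ ys (λ y → ∑ xs (λ x → ⟦ x ∼? y ⟧) ℤ.* f y)
      ≡⟨ Sum.big-cong ys (λ y → cong (ℤ._* f y) (sym (+length-filter (_∼? y) xs))) ⟩
    ∑ ys (λ y → + length (filter (_∼? y) xs) ℤ.* f y) ∎
    where
    ys = deduplicate _∼?_ xs
    move : ∀ x y → ⟦ x ∼? y ⟧ ℤ.* f x ≡ ⟦ x ∼? y ⟧ ℤ.* f y
    move x y with x ∼? y
    ... | yes x∼y = cong (1ℤ ℤ.*_) (f-resp x∼y)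
    ... | no _    = refl

-- The general distributive law: choosing one summand from each factor of a product of sums is
-- choosing a vector. Read one way it expands the product over the pairs (k , l), read the other way
-- it factors the number of tuples of permutations.
∑-vectors : {X : Set} (xs : List X) {n : ℕ} (f : Fin n → X → ℤ) →
  ∑ (vectors xs n) (λ v → ∏ (λ i → f i (lookup v i))) ≡ ∏ (λ i → ∑ xs (f i))
∑-vectors xs {zero}  f = refl
∑-vectors xs {suc n} f = begin
  ∑ (vectors xs (suc n)) (λ v → ∏ (λ i → f i (lookup v i)))
    ≡⟨ Sum.big-cartesianProductWith _∷_ xs (vectors xs n) _ ⟩
  ∑ xs (λ x → ∑ (vectors xs n) (λ v → f zero x ℤ.* ∏ (λ i → f (suc i) (lookup v i))))
    ≡⟨ Sum.big-cong xs (λ x → ∑-*ˡ (vectors xs n) (f zero x) _) ⟩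
  ∑ xs (λ x → f zero x ℤ.* ∑ (vectors xs n) (λ v → ∏ (λ i → f (suc i) (lookup v i))))
    ≡⟨ ∑-*ʳ xs _ (f zero) ⟩
  ∑ xs (f zero) ℤ.* ∑ (vectors xs n) (λ v → ∏ (λ i → f (suc i) (lookup v i)))
    ≡⟨ cong (∑ xs (f zero) ℤ.*_) (∑-vectors xs (f ∘ suc)) ⟩
  ∑ xs (f zero) ℤ.* ∏ (λ i → ∑ xs (f (suc i))) ∎

∈-vectors⁺ : {X : Set} {xs : List X} {n : ℕ} (v : Vec X n) → (∀ i → lookup v i ∈ xs) → v ∈ vectors xs n
∈-vectors⁺ []      _  = here refl
∈-vectors⁺ (x ∷ v) v⊆ = ∈-cartesianProductWith⁺ _∷_ (v⊆ zero) (∈-vectors⁺ v (v⊆ ∘ suc))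

∈-vectors⁻ : {X : Set} {xs : List X} {n : ℕ} {v : Vec X n} → v ∈ vectors xs n → ∀ i → lookup v i ∈ xs
∈-vectors⁻ {xs = xs} {suc n} v∈ i with ∈-cartesianProductWith⁻ _∷_ xs (vectors xs n) v∈
∈-vectors⁻ v∈ zero    | _ , _ , x∈ , _  , refl = x∈
∈-vectors⁻ v∈ (suc i) | _ , _ , _  , w∈ , refl = ∈-vectors⁻ w∈ i

vectors⁺ : {X : Set} {xs : List X} → Unique xs → ∀ n → Unique (vectors xs n)
vectors⁺ u zero    = [] ∷ []
vectors⁺ u (suc n) = cartesianProductWith⁺ _∷_ ∷-injective u (vectors⁺ u n)

-- Completions of a partial permutation

+∣_∣ : ∀ {n} (s : Subset n) → + ∣ s ∣ ≡ Sum.bigFin (λ i → ⟦ lookup s i Bool.≟ true ⟧)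
+∣ [] ∣        = refl
+∣ true ∷ s ∣  = cong (ℤ._+_ 1ℤ) +∣ s ∣
+∣ false ∷ s ∣ = trans +∣ s ∣ (sym (ℤ.+-identityˡ _))

module Completions {X : Set} (_≟_ : DecidableEquality X) where

  unique? : ∀ {n} → Decidable (Uniqueᵥ.Unique {n = n})
  unique? = AllPairsᵥ.allPairs? (λ x y → ¬? (x ≟ y))

  infixl 6 _−_
  _−_ : List X → X → List X
  L − x = filter (λ y → ¬? (x ≟ y)) L

  length-− : ∀ {L x} → Unique L → x ∈ L → suc (length (L − x)) ≡ length L
  length-− {L} {x} u x∈L = ℤ.+-injective (begin
    1ℤ ℤ.+ + length (L − x)
      ≡⟨ cong₂ ℤ._+_ (sym (∑-delta (x ≟_) (λ _ → 1ℤ) u x∈L)) (+length-filter (λ y → ¬? (x ≟ y)) L) ⟩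
    ∑ L (λ y → ⟦ x ≟ y ⟧ ℤ.* 1ℤ) ℤ.+ ∑ L (λ y → ⟦ ¬? (x ≟ y) ⟧)
      ≡⟨ sym (Sum.big-∙ L _ _) ⟩
    ∑ L (λ y → ⟦ x ≟ y ⟧ ℤ.* 1ℤ ℤ.+ ⟦ ¬? (x ≟ y) ⟧)
      ≡⟨ Sum.big-cong L (λ y → complement (x ≟ y)) ⟩
    ∑ L (λ _ → 1ℤ)
      ≡⟨ sym (+length L) ⟩
    + length L ∎)
    where
    complement : {P : Set} (d : Dec P) → ⟦ d ⟧ ℤ.* 1ℤ ℤ.+ ⟦ ¬? d ⟧ ≡ 1ℤ
    complement (yes _) = refl
    complement (no _)  = refl

  -- Moves the condition of avoiding x from the vectors to their alphabet. Once the first entry of a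
  -- vector with distinct entries is fixed, the remaining ones thus range over a smaller list.
  ∑-vectors-avoiding : ∀ L x {n} (f : Vec X n → ℤ) →
    ∑ (vectors L n) (λ v → ⟦ Allᵥ.all? (λ y → ¬? (x ≟ y)) v ⟧ ℤ.* f v) ≡ ∑ (vectors (L − x) n) f
  ∑-vectors-avoiding L x {zero}  f = cong (ℤ._+ 0ℤ) (ℤ.*-identityˡ (f []))
  ∑-vectors-avoiding L x {suc n} f = begin
    ∑ (vectors L (suc n)) (λ v → ⟦ Allᵥ.all? (λ y → ¬? (x ≟ y)) v ⟧ ℤ.* f v)
      ≡⟨ Sum.big-cartesianProductWith _∷_ L (vectors L n) _ ⟩
    ∑ L (λ z → ∑ (vectors L n) (λ v → ⟦ Allᵥ.all? (λ y → ¬? (x ≟ y)) (z ∷ v) ⟧ ℤ.* f (z ∷ v)))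
      ≡⟨ Sum.big-cong L step ⟩
    ∑ L (λ z → ⟦ ¬? (x ≟ z) ⟧ ℤ.* ∑ (vectors (L − x) n) (λ v → f (z ∷ v)))
      ≡⟨ sym (∑-filter (λ y → ¬? (x ≟ y)) L _) ⟩
    ∑ (L − x) (λ z → ∑ (vectors (L − x) n) (λ v → f (z ∷ v)))
      ≡⟨ sym (Sum.big-cartesianProductWith _∷_ (L − x) (vectors (L − x) n) f) ⟩
    ∑ (vectors (L − x) (suc n)) f ∎
    where
    avoid? = λ y → ¬? (x ≟ y)
    step : ∀ z → ∑ (vectors L n) (λ v → ⟦ Allᵥ.all? avoid? (z ∷ v) ⟧ ℤ.* f (z ∷ v))
               ≡ ⟦ avoid? z ⟧ ℤ.* ∑ (vectors (L − x) n) (λ v → f (z ∷ v))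
    step z = begin
      ∑ (vectors L n) (λ v → ⟦ avoid? z ×-dec Allᵥ.all? avoid? v ⟧ ℤ.* f (z ∷ v))
        ≡⟨ Sum.big-cong (vectors L n) (λ v →
             trans (cong (ℤ._* f (z ∷ v)) (⟦⟧-× (avoid? z) (Allᵥ.all? avoid? v)))
               (ℤ.*-assoc ⟦ avoid? z ⟧ _ _)) ⟩
      ∑ (vectors L n) (λ v → ⟦ avoid? z ⟧ ℤ.* (⟦ Allᵥ.all? avoid? v ⟧ ℤ.* f (z ∷ v)))
        ≡⟨ ∑-*ˡ (vectors L n) ⟦ avoid? z ⟧ _ ⟩
      ⟦ avoid? z ⟧ ℤ.* ∑ (vectors L n) (λ v → ⟦ Allᵥ.all? avoid? v ⟧ ℤ.* f (z ∷ v))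
        ≡⟨ cong (⟦ avoid? z ⟧ ℤ.*_) (∑-vectors-avoiding L x (λ v → f (z ∷ v))) ⟩
      ⟦ avoid? z ⟧ ℤ.* ∑ (vectors (L − x) n) (λ v → f (z ∷ v)) ∎

  -- The factor of one position in the expanded product: an edge demands agreement, a non-edge
  -- demands nothing.
  agree : Bool → X → X → ℤ
  agree true  x y = ⟦ x ≟ y ⟧
  agree false _ _ = 1ℤ

  agreement : ∀ {n} → Subset n → Vec X n → Vec X n → ℤ
  agreement s a v = ∏ (λ i → agree (lookup s i) (lookup a i) (lookup v i))

  -- For L without repetitions, the number of vectors with distinct entries from L that agree with a
  -- on s. The alphabet is a parameter because the recursion removes the values already used.
  completions : ∀ {n} → List X → Subset n → Vec X n → ℤ
  completions {n} L s a = ∑ (vectors L n) (λ v → ⟦ unique? v ⟧ ℤ.* agreement s a v)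

  completions-∷ : ∀ {n} L b (s : Subset n) x a →
    completions L (b ∷ s) (x ∷ a) ≡ ∑ L (λ y → agree b x y ℤ.* completions (L − y) s a)
  completions-∷ {n} L b s x a = trans
    (Sum.big-cartesianProductWith _∷_ L (vectors L n) _)
    (Sum.big-cong L (λ y → begin
      ∑ (vectors L n) (λ v → ⟦ fresh? y v ×-dec unique? v ⟧ ℤ.* (agree b x y ℤ.* agreement s a v))
        ≡⟨ Sum.big-cong (vectors L n) (λ v → rearrange y v) ⟩
      ∑ (vectors L n) (λ v → agree b x y ℤ.* (⟦ fresh? y v ⟧ ℤ.* (⟦ unique? v ⟧ ℤ.* agreement s a v)))
        ≡⟨ ∑-*ˡ (vectors L n) (agree b x y) _ ⟩
      agree b x y ℤ.* ∑ (vectors L n) (λ v → ⟦ fresh? y v ⟧ ℤ.* (⟦ unique? v ⟧ ℤ.* agreement s a v))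
        ≡⟨ cong (agree b x y ℤ.*_) (∑-vectors-avoiding L y (λ v → ⟦ unique? v ⟧ ℤ.* agreement s a v)) ⟩
      agree b x y ℤ.* completions (L − y) s a ∎))
    where
    fresh? : ∀ y (v : Vec X n) → Dec _
    fresh? y = Allᵥ.all? (λ z → ¬? (y ≟ z))
    rearrange : ∀ y v → ⟦ fresh? y v ×-dec unique? v ⟧ ℤ.* (agree b x y ℤ.* agreement s a v)
      ≡ agree b x y ℤ.* (⟦ fresh? y v ⟧ ℤ.* (⟦ unique? v ⟧ ℤ.* agreement s a v))
    rearrange y v = begin
      ⟦ fresh? y v ×-dec unique? v ⟧ ℤ.* (agree b x y ℤ.* agreement s a v)
        ≡⟨ cong (ℤ._* (agree b x y ℤ.* agreement s a v)) (⟦⟧-× (fresh? y v) (unique? v)) ⟩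
      (⟦ fresh? y v ⟧ ℤ.* ⟦ unique? v ⟧) ℤ.* (agree b x y ℤ.* agreement s a v)
        ≡⟨ x*[y*z]≡y*[x*z] (⟦ fresh? y v ⟧ ℤ.* ⟦ unique? v ⟧) (agree b x y) _ ⟩
      agree b x y ℤ.* ((⟦ fresh? y v ⟧ ℤ.* ⟦ unique? v ⟧) ℤ.* agreement s a v)
        ≡⟨ cong (agree b x y ℤ.*_) (ℤ.*-assoc ⟦ fresh? y v ⟧ _ _) ⟩
      agree b x y ℤ.* (⟦ fresh? y v ⟧ ℤ.* (⟦ unique? v ⟧ ℤ.* agreement s a v)) ∎

  -- Position i would have to take the value x, which is not in the alphabet, so every product
  -- contains a zero factor.
  completions-missing : ∀ {n} L (s : Subset n) (a : Vec X n) x i →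
    lookup s i ≡ true → lookup a i ≡ x → completions (L − x) s a ≡ 0ℤ
  completions-missing {n} L s a x i si refl = Sum.big-ε (vectors (L − x) n) (λ {v} v∈ →
    trans (cong (⟦ unique? v ⟧ ℤ.*_) (∏-zero i (trans (cong (λ b → agree b x (lookup v i)) si)
      (⟦⟧-false (x ≟ lookup v i) (proj₂ (∈-filter⁻ (λ y → ¬? (x ≟ y)) {xs = L} (∈-vectors⁻ v∈ i)))))))
      (ℤ.*-zeroʳ ⟦ unique? v ⟧))

  InjectiveOn : ∀ {n} → Subset n → Vec X n → Set
  InjectiveOn s a = ∀ i j → lookup s i ≡ true → lookup s j ≡ true → lookup a i ≡ lookup a j → i ≡ j

  MapsInto : ∀ {n} → Subset n → Vec X n → List X → Set
  MapsInto s a L = ∀ i → lookup s i ≡ true → lookup a i ∈ L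

  taken? : ∀ {n} (s : Subset n) (a : Vec X n) (x : X) → Dec (∃ λ i → lookup s i ≡ true × lookup a i ≡ x)
  taken? s a x = any? λ i → (lookup s i Bool.≟ true) ×-dec (lookup a i ≟ x)

  -- Injectivity on s leaves at most one index i of s with value x, so the bracket of the
  -- existential statement is the sum of the brackets of its instances.
  ⟦taken?⟧ : ∀ {n} (s : Subset n) (a : Vec X n) → InjectiveOn s a → ∀ x →
    ⟦ taken? s a x ⟧ ≡ ∑ (allFin n) (λ i → ⟦ lookup s i Bool.≟ true ⟧ ℤ.* ⟦ lookup a i ≟ x ⟧)
  ⟦taken?⟧ {n} s a inj x = go (taken? s a x)
    where
    f : Fin n → ℤ
    f i = ⟦ lookup s i Bool.≟ true ⟧ ℤ.* ⟦ lookup a i ≟ x ⟧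
    f-no : ∀ i → ¬ (lookup s i ≡ true × lookup a i ≡ x) → f i ≡ 0ℤ
    f-no i ¬p = trans (sym (⟦⟧-× (lookup s i Bool.≟ true) (lookup a i ≟ x)))
      (⟦⟧-false ((lookup s i Bool.≟ true) ×-dec (lookup a i ≟ x)) ¬p)
    go : (d : Dec (∃ λ i → lookup s i ≡ true × lookup a i ≡ x)) → ⟦ d ⟧ ≡ ∑ (allFin n) f
    go (no ¬t) = sym (Sum.big-ε (allFin n) (λ {i} _ → f-no i (λ p → ¬t (i , p))))
    go (yes (i , si , ai)) = sym (trans
      (Sum.big-only (allFin⁺ n) (∈-allFin i)
        (λ {j} _ i≢j → f-no j (λ (sj , aj) → i≢j (inj i j si sj (trans ai (sym aj))))))
      (cong₂ ℤ._*_ (⟦⟧-true (lookup s i Bool.≟ true) si) (⟦⟧-true (lookup a i ≟ x) ai)))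

  -- Double counting of the pairs of an index in s and its value: as a maps s into L and L has no
  -- repetitions, each index of s meets exactly one x of L.
  ∑-taken : ∀ {n} L (s : Subset n) (a : Vec X n) → Unique L → MapsInto s a L → InjectiveOn s a →
    ∑ L (λ x → ⟦ taken? s a x ⟧) ≡ + ∣ s ∣
  ∑-taken {n} L s a u into inj = begin
    ∑ L (λ x → ⟦ taken? s a x ⟧)
      ≡⟨ Sum.big-cong L (⟦taken?⟧ s a inj) ⟩
    ∑ L (λ x → ∑ (allFin n) (λ i → ⟦ lookup s i Bool.≟ true ⟧ ℤ.* ⟦ lookup a i ≟ x ⟧))
      ≡⟨ Sum.big-comm L (allFin n) _ ⟩
    ∑ (allFin n) (λ i → ∑ L (λ x → ⟦ lookup s i Bool.≟ true ⟧ ℤ.* ⟦ lookup a i ≟ x ⟧))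
      ≡⟨ Sum.big-cong (allFin n)
           (λ i → trans (∑-*ˡ L ⟦ lookup s i Bool.≟ true ⟧ _) (once i (lookup s i Bool.≟ true))) ⟩
    ∑ (allFin n) (λ i → ⟦ lookup s i Bool.≟ true ⟧)
      ≡⟨ Sum.big-allFin (λ i → ⟦ lookup s i Bool.≟ true ⟧) ⟩
    Sum.bigFin (λ i → ⟦ lookup s i Bool.≟ true ⟧)
      ≡⟨ sym +∣ s ∣ ⟩
    + ∣ s ∣ ∎
    where
    once : ∀ i (d : Dec (lookup s i ≡ true)) → ⟦ d ⟧ ℤ.* ∑ L (λ x → ⟦ lookup a i ≟ x ⟧) ≡ ⟦ d ⟧
    once i (no _)   = refl
    once i (yes si) = trans (ℤ.*-identityˡ _)
      (trans (Sum.big-cong L (λ x → sym (ℤ.*-identityʳ ⟦ lookup a i ≟ x ⟧)))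
        (∑-delta (lookup a i ≟_) (λ _ → 1ℤ) u (into i si)))

  -- Induction on the length. A prescribed first entry is forced, and n and ∣ s ∣ both drop by one,
  -- so their difference stays. A free first entry can be any value of L not prescribed later, of
  -- which there are suc n - ∣ s ∣. Each choice leaves (n - ∣ s ∣)! completions, and the factorial
  -- grows by one factor.
  completions-! : ∀ {n} L (s : Subset n) (a : Vec X n) → Unique L → length L ≡ n →
    MapsInto s a L → InjectiveOn s a → completions L s a ≡ + ((n ∸ ∣ s ∣) !)
  completions-! L []          []      u len into inj = refl
  completions-! {suc n} L (true ∷ s)  (x ∷ a) u len into inj = begin
    completions L (true ∷ s) (x ∷ a)
      ≡⟨ completions-∷ L true s x a ⟩
    ∑ L (λ y → ⟦ x ≟ y ⟧ ℤ.* completions (L − y) s a)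
      ≡⟨ ∑-delta (x ≟_) (λ y → completions (L − y) s a) u x∈L ⟩
    completions (L − x) s a
      ≡⟨ completions-! (L − x) s a (filter⁺ _ u) (ℕ.suc-injective (trans (length-− u x∈L) len))
           (λ i si → ∈-filter⁺ _ (into (suc i) si)
             (λ eq → contradiction (inj zero (suc i) refl si eq) λ ()))
           (λ i j si sj eq → suc-injective (inj (suc i) (suc j) si sj eq)) ⟩
    + ((n ∸ ∣ s ∣) !) ∎
    where x∈L = into zero refl
  completions-! {suc n} L (false ∷ s) (x ∷ a) u len into inj = begin
    completions L (false ∷ s) (x ∷ a)
      ≡⟨ completions-∷ L false s x a ⟩
    ∑ L (λ y → 1ℤ ℤ.* completions (L − y) s a)
      ≡⟨ Sum.big-cong-∈ L (λ {y} y∈L → trans (ℤ.*-identityˡ _) (each y y∈L (taken? s a y))) ⟩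
    ∑ L (λ y → ⟦ ¬? (taken? s a y) ⟧ ℤ.* k!)
      ≡⟨ ∑-*ʳ L k! _ ⟩
    ∑ L (λ y → ⟦ ¬? (taken? s a y) ⟧) ℤ.* k!
      ≡⟨ cong (ℤ._* k!) count ⟩
    + suc (n ∸ ∣ s ∣) ℤ.* k!
      ≡⟨ sym (ℤ.pos-* (suc (n ∸ ∣ s ∣)) ((n ∸ ∣ s ∣) !)) ⟩
    + (suc (n ∸ ∣ s ∣) !)
      -- The truncated subtraction commutes with `suc` because ∣ s ∣ ≤ n.
      ≡⟨ cong (λ k → + (k !)) (sym (ℕ.+-∸-assoc 1 (∣p∣≤n s))) ⟩
    + ((suc n ∸ ∣ s ∣) !) ∎
    where
    k! = + ((n ∸ ∣ s ∣) !)
    into′ : MapsInto s a L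
    into′ i = into (suc i)
    inj′ : InjectiveOn s a
    inj′ i j si sj eq = suc-injective (inj (suc i) (suc j) si sj eq)
    each : ∀ y → y ∈ L → (d : Dec (∃ λ i → lookup s i ≡ true × lookup a i ≡ y)) →
      completions (L − y) s a ≡ ⟦ ¬? d ⟧ ℤ.* k!
    each y y∈L (yes (i , si , ai)) = completions-missing L s a y i si ai
    each y y∈L (no free) = trans
      (completions-! (L − y) s a (filter⁺ _ u) (ℕ.suc-injective (trans (length-− u y∈L) len))
        (λ i si → ∈-filter⁺ _ (into′ i si) (λ eq → free (i , si , sym eq))) inj′)
      (sym (ℤ.*-identityˡ k!))
    complement : {P : Set} (d : Dec P) → ⟦ ¬? d ⟧ ℤ.+ ⟦ d ⟧ ≡ 1ℤ
    complement (yes _) = refl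
    complement (no _)  = refl
    count : ∑ L (λ y → ⟦ ¬? (taken? s a y) ⟧) ≡ + suc (n ∸ ∣ s ∣)
    -- Adding ∣ s ∣, which is the number of taken values, completes the count of free values to the
    -- length of L and avoids subtraction.
    count = +-cancelʳ (+ ∣ s ∣) _ _ (begin
      ∑ L (λ y → ⟦ ¬? (taken? s a y) ⟧) ℤ.+ + ∣ s ∣
        ≡⟨ cong (ℤ._+_ (∑ L (λ y → ⟦ ¬? (taken? s a y) ⟧))) (sym (∑-taken L s a u into′ inj′)) ⟩
      ∑ L (λ y → ⟦ ¬? (taken? s a y) ⟧) ℤ.+ ∑ L (λ y → ⟦ taken? s a y ⟧)
        ≡⟨ sym (Sum.big-∙ L _ _) ⟩
      ∑ L (λ y → ⟦ ¬? (taken? s a y) ⟧ ℤ.+ ⟦ taken? s a y ⟧)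
        ≡⟨ Sum.big-cong L (λ y → complement (taken? s a y)) ⟩
      ∑ L (λ _ → 1ℤ)
        ≡⟨ sym (+length L) ⟩
      + length L
        ≡⟨ cong +_ (trans len (cong suc (sym (ℕ.m∸n+n≡m (∣p∣≤n s))))) ⟩
      + suc (n ∸ ∣ s ∣) ℤ.+ + ∣ s ∣ ∎)

open module FinCompletions {n : ℕ} = Completions (_≟_ {n})

lookup-ext : {X : Set} {n : ℕ} {v w : Vec X n} → lookup v ≗ lookup w → v ≡ w
lookup-ext {v = v} {w} eq =
  trans (sym (tabulate∘lookup v)) (trans (tabulate-cong eq) (tabulate∘lookup w))

does⇒ : {P : Set} (d : Dec P) → does d ≡ true → P
does⇒ (yes p) _ = p

-- Pigeonhole: if y were missed, deleting it from the codomain with `punchOut` would give an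
-- injection of n + 1 elements into n.
injective⇒surjective : ∀ {n} {f : Fin n → Fin n} → (∀ {i j} → f i ≡ f j → i ≡ j) → ∀ y → ∃ λ x → f x ≡ y
injective⇒surjective {suc n} {f} inj y with any? (λ x → f x ≟ y)
... | yes hit = hit
... | no miss = contradiction
  (injective⇒≤ {f = λ x → punchOut (avoid x)}
    (λ eq → inj (punchOut-injective (avoid _) (avoid _) eq))) ℕ.1+n≰n
  where
  avoid : ∀ x → y ≢ f x
  avoid x eq = miss (x , sym eq)

-- S-permutation matrices as pairs of tuples of permutations

Table : ℕ → Set
Table n = Vec (Vec (Fin n) n) n

infix 9 _⟪_,_⟫
_⟪_,_⟫ : ∀ {n} → Table n → Fin n → Fin n → Fin n
ρ ⟪ k , l ⟫ = lookup (lookup ρ k) l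

-- Row k of ρ lists the rows, and row l of σ the columns, of the 1s inside the blocks of
-- the k-th band and of the l-th stack.
blockEntry : ∀ {n} → Table n → Table n → Fin n × Fin n → Fin n × Fin n → Bool
blockEntry ρ σ (k , i) (l , j) = does ((ρ ⟪ k , l ⟫ ≟ i) ×-dec (σ ⟪ l , k ⟫ ≟ j))

sMatrix : ∀ {n} → Table n → Table n → BinaryMatrix (n * n) (n * n)
sMatrix {n} ρ σ = tabulate λ i → tabulate λ j → blockEntry ρ σ (remQuot n i) (remQuot n j)

entry-tabulate : ∀ {m n} (f : Fin m → Fin n → Bool) i j →
  entry (tabulate (λ i → tabulate (f i))) i j ≡ f i j
entry-tabulate f i j =
  trans (cong (λ v → lookup v j) (lookup∘tabulate (λ i → tabulate (f i)) i)) (lookup∘tabulate (f i) j)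

module _ {n : ℕ} (ρ σ : Table n) where

  entry-sMatrix : ∀ k i l j → entry (sMatrix ρ σ) (combine k i) (combine l j)
    ≡ blockEntry ρ σ (k , i) (l , j)
  entry-sMatrix k i l j = trans
    (entry-tabulate (λ i j → blockEntry ρ σ (remQuot n i) (remQuot n j)) (combine k i) (combine l j))
    (cong₂ (blockEntry ρ σ) (remQuot-combine k i) (remQuot-combine l j))

  entry-sMatrix⁺ : ∀ k l → entry (sMatrix ρ σ) (combine k (ρ ⟪ k , l ⟫)) (combine l (σ ⟪ l , k ⟫))
    ≡ true
  entry-sMatrix⁺ k l = trans (entry-sMatrix k _ l _) 
    (dec-true ((ρ ⟪ k , l ⟫ ≟ _) ×-dec (σ ⟪ l , k ⟫ ≟ _)) (refl , refl))

  entry-sMatrix⁻ : ∀ k i l j → entry (sMatrix ρ σ) (combine k i) (combine l j) ≡ true →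
    ρ ⟪ k , l ⟫ ≡ i × σ ⟪ l , k ⟫ ≡ j
  entry-sMatrix⁻ k i l j eq = does⇒ ((_ ≟ _) ×-dec (_ ≟ _)) (trans (sym (entry-sMatrix k i l j)) eq)

entry-block : ∀ n (A : BinaryMatrix (n * n) (n * n)) k l i j →
  entry (block {n} A k l) i j ≡ entry A (combine k i) (combine l j)
entry-block n A k l = entry-tabulate {n} {n} (λ i j → entry A (combine k i) (combine l j))

permutations : (n : ℕ) → List (Vec (Fin n) n)
permutations n = filter unique? (vectors (allFin n) n)

permutationTuples : (n : ℕ) → List (Table n)
permutationTuples n = vectors (permutations n) n

∈-permutations⁺ : ∀ {n} {π : Vec (Fin n) n} → Uniqueᵥ.Unique π → π ∈ permutations n
∈-permutations⁺ {π = π} u = ∈-filter⁺ unique? (∈-vectors⁺ π (λ i → ∈-allFin (lookup π i))) u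

∈-permutations⁻ : ∀ {n} {π : Vec (Fin n) n} → π ∈ permutations n → Uniqueᵥ.Unique π
∈-permutations⁻ {n} π∈ = proj₂ (∈-filter⁻ unique? {xs = vectors (allFin n) n} π∈)

AllUnique : ∀ {n} → Table n → Set
AllUnique ρ = ∀ k → Uniqueᵥ.Unique (lookup ρ k)

-- Row i′ of the k-th band contains the 1 of block (k , l) exactly when ρ_k(l) = i′. Since ρ_k is
-- injective, hence bijective, this happens for exactly one l. Columns are treated in the same way
-- with σ_l, and each block has its single 1 by construction.
sMatrix-isSPermutation : ∀ {n} (ρ σ : Table n) → AllUnique ρ → AllUnique σ →
  IsSPermutation n (sMatrix ρ σ)
sMatrix-isSPermutation {n} ρ σ uρ uσ = record { row = row ; column = column ; blocks = blocks }
  where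
  row : ∀ i → ∃! _≡_ λ j → entry (sMatrix ρ σ) i j ≡ true
  row i with combine-surjective {n} {n} i
  ... | k , i′ , refl with injective⇒surjective (Uniqueᵥ.lookup-injective (uρ k) _ _) i′
  ... | l , refl = combine l (σ ⟪ l , k ⟫) , entry-sMatrix⁺ ρ σ k l , unique
    where
    unique : ∀ {j} → entry (sMatrix ρ σ) (combine k (ρ ⟪ k , l ⟫)) j ≡ true →
      combine l (σ ⟪ l , k ⟫) ≡ j
    unique {j} eq with combine-surjective {n} {n} j
    ... | l′ , j′ , refl with entry-sMatrix⁻ ρ σ k _ l′ j′ eq
    ... | ρ≡ , refl with Uniqueᵥ.lookup-injective (uρ k) _ _ ρ≡
    ... | refl = refl

  column : ∀ j → ∃! _≡_ λ i → entry (sMatrix ρ σ) i j ≡ true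
  column j with combine-surjective {n} {n} j
  ... | l , j′ , refl with injective⇒surjective (Uniqueᵥ.lookup-injective (uσ l) _ _) j′
  ... | k , refl = combine k (ρ ⟪ k , l ⟫) , entry-sMatrix⁺ ρ σ k l , unique
    where
    unique : ∀ {i} → entry (sMatrix ρ σ) i (combine l (σ ⟪ l , k ⟫)) ≡ true →
      combine k (ρ ⟪ k , l ⟫) ≡ i
    unique {i} eq with combine-surjective {n} {n} i
    ... | k′ , i′ , refl with entry-sMatrix⁻ ρ σ k′ i′ l _ eq
    ... | refl , σ≡ with Uniqueᵥ.lookup-injective (uσ l) _ _ σ≡
    ... | refl = refl

  blocks : ∀ k l → ∃! _≡_ λ ((i , j) : Fin n × Fin n) → entry (block (sMatrix ρ σ) k l) i j ≡ true
  blocks k l = (ρ ⟪ k , l ⟫ , σ ⟪ l , k ⟫)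
    , trans (entry-block n (sMatrix ρ σ) k l _ _) (entry-sMatrix⁺ ρ σ k l)
    , λ {(i , j)} eq → pair (entry-sMatrix⁻ ρ σ k i l j
      (trans (sym (entry-block n (sMatrix ρ σ) k l i j)) eq))
    where
    pair : ∀ {a b c d : Fin n} → a ≡ c × b ≡ d → (a , b) ≡ (c , d)
    pair (refl , refl) = refl

module _ {n : ℕ} {A : BinaryMatrix (n * n) (n * n)} (s : IsSPermutation n A) where
  open IsSPermutation s

  private
    r c : Fin n → Fin n → Fin n
    r k l = proj₁ (proj₁ (blocks k l))
    c k l = proj₂ (proj₁ (blocks k l))

    one : ∀ k l → entry A (combine k (r k l)) (combine l (c k l)) ≡ true
    one k l = trans (sym (entry-block n A k l _ _)) (proj₁ (proj₂ (blocks k l)))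

    only : ∀ k l i j → entry A (combine k i) (combine l j) ≡ true → r k l ≡ i × c k l ≡ j
    only k l i j eq with refl ← proj₂ (proj₂ (blocks k l)) {i , j}
      (trans (entry-block n A k l i j) eq) = refl , refl

    ∃!-≡ : ∀ {m} {P : Fin m → Set} {x y : Fin m} → ∃! _≡_ P → P x → P y → x ≡ y
    ∃!-≡ (_ , _ , u) px py = trans (sym (u px)) (u py)

    -- Two blocks of one band with their 1s in the same row would put two 1s in that row, so their
    -- columns coincide and with them the indices of the stacks.
    r-injective : ∀ k {l l′} → r k l ≡ r k l′ → l ≡ l′
    r-injective k {l} {l′} eq = proj₁ (combine-injective l (c k l) l′ (c k l′)
      (∃!-≡ (row (combine k (r k l))) (one k l)
        (subst (λ i → entry A (combine k i) (combine l′ (c k l′)) ≡ true) (sym eq) (one k l′))))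

    c-injective : ∀ l {k k′} → c k l ≡ c k′ l → k ≡ k′
    c-injective l {k} {k′} eq = proj₁ (combine-injective k (r k l) k′ (r k′ l)
      (∃!-≡ (column (combine l (c k l))) (one k l)
        (subst (λ j → entry A (combine k′ (r k′ l)) (combine l j) ≡ true) (sym eq) (one k′ l))))

  blockRows blockColumns : Table n
  blockRows    = tabulate λ k → tabulate (r k)
  blockColumns = tabulate λ l → tabulate (λ k → c k l)

  blockRows-unique : AllUnique blockRows
  blockRows-unique k = subst Uniqueᵥ.Unique (sym (lookup∘tabulate _ k))
    (Uniqueᵥ.tabulate⁺ (r-injective k))

  blockColumns-unique : AllUnique blockColumns
  blockColumns-unique l = subst Uniqueᵥ.Unique (sym (lookup∘tabulate _ l))
    (Uniqueᵥ.tabulate⁺ (c-injective l))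

  private
    lookup-rows : ∀ k l → blockRows ⟪ k , l ⟫ ≡ r k l
    lookup-rows k l = trans (cong (λ v → lookup v l) (lookup∘tabulate _ k)) (lookup∘tabulate (r k) l)

    lookup-columns : ∀ l k → blockColumns ⟪ l , k ⟫ ≡ c k l
    lookup-columns l k = trans (cong (λ v → lookup v k) (lookup∘tabulate _ l))
      (lookup∘tabulate (λ k → c k l) k)

  -- Boolean entries are equal once the 1s are in the same places, and the block condition allows a
  -- 1 in block (k , l) only at (r k l , c k l).
  ≡-sMatrix : A ≡ sMatrix blockRows blockColumns
  ≡-sMatrix = lookup-ext λ i → lookup-ext λ j → same i j
    where
    same : ∀ i j → entry A i j ≡ entry (sMatrix blockRows blockColumns) i j
    same i j with combine-surjective {n} {n} i | combine-surjective {n} {n} j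
    ... | k , i′ , refl | l , j′ , refl = Bool.⇔→≡ {z = true} (mk⇔ to from)
      where
      to : entry A (combine k i′) (combine l j′) ≡ true →
        entry (sMatrix blockRows blockColumns) (combine k i′) (combine l j′) ≡ true
      to eq with only k l i′ j′ eq
      ... | r≡ , c≡ = trans (entry-sMatrix blockRows blockColumns k i′ l j′)
        (dec-true ((_ ≟ _) ×-dec (_ ≟ _)) (trans (lookup-rows k l) r≡ , trans (lookup-columns l k) c≡))
      from : entry (sMatrix blockRows blockColumns) (combine k i′) (combine l j′) ≡ true →
        entry A (combine k i′) (combine l j′) ≡ true
      from eq with entry-sMatrix⁻ blockRows blockColumns k i′ l j′ eq
      ... | refl , refl rewrite lookup-rows k l | lookup-columns l k = one k l

-- The 1 of block (k , l) of the first matrix is also a 1 of the second, where the only 1 of that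
-- block is placed by ρ′ and σ′.
sMatrix-injective : ∀ {n} {ρ ρ′ σ σ′ : Table n} →
  sMatrix ρ σ ≡ sMatrix ρ′ σ′ → ρ ≡ ρ′ × σ ≡ σ′
sMatrix-injective {n} {ρ} {ρ′} {σ} {σ′} eq =
    lookup-ext (λ k → lookup-ext (λ l → sym (proj₁ (agrees k l))))
  , lookup-ext (λ l → lookup-ext (λ k → sym (proj₂ (agrees k l))))
  where
  agrees : ∀ k l → ρ′ ⟪ k , l ⟫ ≡ ρ ⟪ k , l ⟫ × σ′ ⟪ l , k ⟫ ≡ σ ⟪ l , k ⟫
  agrees k l = entry-sMatrix⁻ ρ′ σ′ k _ l _
    (subst (λ M → entry M (combine k (ρ ⟪ k , l ⟫)) (combine l (σ ⟪ l , k ⟫)) ≡ true) eq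
      (entry-sMatrix⁺ ρ σ k l))

bits-unique : Unique bits
bits-unique = ((λ ()) ∷ []) ∷ [] ∷ []

∈-bits : ∀ b → b ∈ bits
∈-bits false = here refl
∈-bits true  = there (here refl)

-- Turns the sum over all S-permutation matrices into a double sum over ρ and σ. Neither list has
-- repetitions, so comparing their members is enough.
sPermutationMatrices-↭ : ∀ n →
  sPermutationMatrices n ↭
  cartesianProductWith sMatrix (permutationTuples n) (permutationTuples n)
sPermutationMatrices-↭ n = unique-↭
  (filter⁺ (isSPermutation? n) (vectors⁺ (vectors⁺ bits-unique (n * n)) (n * n)))
  (cartesianProductWith⁺ sMatrix sMatrix-injective tuples-unique tuples-unique)
  to from
  where
  tuples-unique : Unique (permutationTuples n)
  tuples-unique = vectors⁺ (filter⁺ unique? (vectors⁺ (allFin⁺ n) n)) n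

  to : ∀ {B} → B ∈ sPermutationMatrices n →
    B ∈ cartesianProductWith sMatrix (permutationTuples n) (permutationTuples n)
  to {B} B∈ = subst (_∈ cartesianProductWith sMatrix (permutationTuples n) (permutationTuples n))
    (sym (≡-sMatrix s))
    (∈-cartesianProductWith⁺ sMatrix
      (∈-vectors⁺ (blockRows s) (λ k → ∈-permutations⁺ (blockRows-unique s k)))
      (∈-vectors⁺ (blockColumns s) (λ l → ∈-permutations⁺ (blockColumns-unique s l))))
    where
    s : IsSPermutation n B
    s = proj₂ (∈-filter⁻ (isSPermutation? n) {xs = binaryMatrices (n * n) (n * n)} B∈)

  from : ∀ {B} → B ∈ cartesianProductWith sMatrix (permutationTuples n) (permutationTuples n) →
    B ∈ sPermutationMatrices n
  from B∈ with ∈-cartesianProductWith⁻ sMatrix (permutationTuples n) (permutationTuples n) B∈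
  ... | ρ , σ , ρ∈ , σ∈ , refl = ∈-filter⁺ (isSPermutation? n)
    (∈-vectors⁺ _ (λ i → ∈-vectors⁺ _ (λ j → ∈-bits _)))
    (sMatrix-isSPermutation ρ σ (∈-permutations⁻ ∘ ∈-vectors⁻ ρ∈) (∈-permutations⁻ ∘ ∈-vectors⁻ σ∈))

-- Inclusion–exclusion

⟦all?⟧ : ∀ {n} {P : Fin n → Set} (P? : Decidable P) → ⟦ all? P? ⟧ ≡ ∏ (λ i → ⟦ P? i ⟧)
⟦all?⟧ {zero}  P? = ⟦⟧-true (all? P?) (λ ())
⟦all?⟧ {suc n} P? = begin
  ⟦ all? P? ⟧
    ≡⟨ ⟦⟧-cong (all? P?) (P? zero ×-dec all? (P? ∘ suc)) (λ p → p zero , p ∘ suc)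
         (λ { (p , q) zero → p ; (p , q) (suc i) → q i }) ⟩
  ⟦ P? zero ×-dec all? (P? ∘ suc) ⟧
    ≡⟨ ⟦⟧-× (P? zero) (all? (P? ∘ suc)) ⟩
  ⟦ P? zero ⟧ ℤ.* ⟦ all? (P? ∘ suc) ⟧
    ≡⟨ cong (⟦ P? zero ⟧ ℤ.*_) (⟦all?⟧ (P? ∘ suc)) ⟩
  ⟦ P? zero ⟧ ℤ.* ∏ (λ i → ⟦ P? (suc i) ⟧) ∎

-- Each edge stands for a choice of the negative summand in a factor 1 - [agreement].
sgn : Bool → ℤ
sgn true  = -1ℤ
sgn false = 1ℤ

sign : ∀ {n} → Graph n → ℤ
sign g = ∏ (λ k → ∏ (λ l → sgn (lookup (lookup g k) l)))

-- The neighbourhood of c_l, as `lookup g k` is that of r_k.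
column : ∀ {n} → Graph n → Fin n → Subset n
column g l = Vec.map (λ row → lookup row l) g

module _ {n : ℕ} (α β ρ σ : Table n) where

  private
    meet? : ∀ k l → Dec (α ⟪ k , l ⟫ ≡ ρ ⟪ k , l ⟫ × β ⟪ l , k ⟫ ≡ σ ⟪ l , k ⟫)
    meet? k l = (α ⟪ k , l ⟫ ≟ ρ ⟪ k , l ⟫) ×-dec (β ⟪ l , k ⟫ ≟ σ ⟪ l , k ⟫)

    free⇒disjoint : (∀ k l → ¬ (α ⟪ k , l ⟫ ≡ ρ ⟪ k , l ⟫ × β ⟪ l , k ⟫ ≡ σ ⟪ l , k ⟫)) →
      Disjoint (sMatrix α β) (sMatrix ρ σ)
    free⇒disjoint free (i , j , p , q)
      with combine-surjective {n} {n} i | combine-surjective {n} {n} j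
    ... | k , i′ , refl | l , j′ , refl
      with entry-sMatrix⁻ α β k i′ l j′ p | entry-sMatrix⁻ ρ σ k i′ l j′ q
    ... | a , b | c , d = free k l (trans a (sym c) , trans b (sym d))

    disjoint⇒free : Disjoint (sMatrix α β) (sMatrix ρ σ) →
      ∀ k l → ¬ (α ⟪ k , l ⟫ ≡ ρ ⟪ k , l ⟫ × β ⟪ l , k ⟫ ≡ σ ⟪ l , k ⟫)
    disjoint⇒free disj k l (a , b) = disj (_ , _ , entry-sMatrix⁺ α β k l ,
      trans (cong₂ (λ i j → entry (sMatrix ρ σ) (combine k i) (combine l j)) a b)
        (entry-sMatrix⁺ ρ σ k l))

    -- The two summands of 1 - [α_k(l) = ρ_k(l)] [β_l(k) = σ_l(k)], selected by a bit.
    term : Fin n → Fin n → Bool → ℤ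
    term k l b = sgn b ℤ.* (agree b (α ⟪ k , l ⟫) (ρ ⟪ k , l ⟫)
                            ℤ.* agree b (β ⟪ l , k ⟫) (σ ⟪ l , k ⟫))

    ⟦¬meet⟧ : ∀ k l → ⟦ ¬? (meet? k l) ⟧ ≡ ∑ bits (term k l)
    ⟦¬meet⟧ k l = trans (⟦⟧-¬ (meet? k l)) (cong (ℤ._+_ 1ℤ) (trans
      (cong (-1ℤ ℤ.*_) (⟦⟧-× (α ⟪ k , l ⟫ ≟ ρ ⟪ k , l ⟫) (β ⟪ l , k ⟫ ≟ σ ⟪ l , k ⟫)))
      -- The trailing 0 ends the fold over `bits`, whose first summand, for `false`, computes to 1.
      (sym (ℤ.+-identityʳ _))))

    -- Separates what depends on ρ from what depends on σ: agreements of α with ρ are grouped by the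
    -- rows of g, those of β with σ by its columns, after the two products are exchanged.
    ∏-term : ∀ g → ∏ (λ k → ∏ (λ l → term k l (lookup (lookup g k) l)))
      ≡ sign g ℤ.* (∏ (λ k → agreement (lookup g k) (lookup α k) (lookup ρ k))
                    ℤ.* ∏ (λ l → agreement (column g l) (lookup β l) (lookup σ l)))
    ∏-term g = begin
      ∏ (λ k → ∏ (λ l → s k l ℤ.* (a k l ℤ.* b k l)))
        ≡⟨ Prod.bigFin-cong (λ k → trans (Prod.bigFin-∙ (s k) (λ l → a k l ℤ.* b k l))
             (cong (∏ (s k) ℤ.*_) (Prod.bigFin-∙ (a k) (b k)))) ⟩
      ∏ (λ k → ∏ (s k) ℤ.* (∏ (a k) ℤ.* ∏ (b k)))
        ≡⟨ trans (Prod.bigFin-∙ (λ k → ∏ (s k)) (λ k → ∏ (a k) ℤ.* ∏ (b k)))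
             (cong (sign g ℤ.*_) (Prod.bigFin-∙ (λ k → ∏ (a k)) (λ k → ∏ (b k)))) ⟩
      sign g ℤ.* (∏ (λ k → ∏ (a k)) ℤ.* ∏ (λ k → ∏ (b k)))
        ≡⟨ cong (λ z → sign g ℤ.* (∏ (λ k → ∏ (a k)) ℤ.* z)) (trans (Prod.bigFin-comm b)
             (Prod.bigFin-cong (λ l → Prod.bigFin-cong (λ k →
               cong (λ e → agree e (β ⟪ l , k ⟫) (σ ⟪ l , k ⟫))
                 (sym (lookup-map k (λ row → lookup row l) g)))))) ⟩
      sign g ℤ.* (∏ (λ k → ∏ (a k)) ℤ.* ∏ (λ l → agreement (column g l) (lookup β l) (lookup σ l))) ∎
      where
      s a b : Fin n → Fin n → ℤ
      s k l = sgn (lookup (lookup g k) l)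
      a k l = agree (lookup (lookup g k) l) (α ⟪ k , l ⟫) (ρ ⟪ k , l ⟫)
      b k l = agree (lookup (lookup g k) l) (β ⟪ l , k ⟫) (σ ⟪ l , k ⟫)

  -- Disjointness means that no block has its 1 at the same place in both matrices, so its bracket
  -- is a product over (k , l). Distributivity is applied inside each row and then across the rows,
  -- and the choices made form a vector of vectors of bits, that is, a graph.
  ⟦disjoint⟧ : ⟦ disjoint? (sMatrix α β) (sMatrix ρ σ) ⟧ ≡
    ∑ (vectors (vectors bits n) n) (λ g →
      sign g ℤ.* (∏ (λ k → agreement (lookup g k) (lookup α k) (lookup ρ k))
                  ℤ.* ∏ (λ l → agreement (column g l) (lookup β l) (lookup σ l))))
  ⟦disjoint⟧ = begin
    ⟦ disjoint? (sMatrix α β) (sMatrix ρ σ) ⟧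
      ≡⟨ ⟦⟧-cong (disjoint? (sMatrix α β) (sMatrix ρ σ))
           (all? λ k → all? λ l → ¬? (meet? k l)) disjoint⇒free free⇒disjoint ⟩
    ⟦ (all? λ k → all? λ l → ¬? (meet? k l)) ⟧
      ≡⟨ ⟦all?⟧ (λ k → all? λ l → ¬? (meet? k l)) ⟩
    ∏ (λ k → ⟦ (all? λ l → ¬? (meet? k l)) ⟧)
      ≡⟨ Prod.bigFin-cong (λ k → trans (⟦all?⟧ (λ l → ¬? (meet? k l)))
           (trans (Prod.bigFin-cong (⟦¬meet⟧ k)) (sym (∑-vectors bits (term k))))) ⟩
    ∏ (λ k → ∑ (vectors bits n) (λ s → ∏ (λ l → term k l (lookup s l))))
      ≡⟨ sym (∑-vectors (vectors bits n) (λ k s → ∏ (λ l → term k l (lookup s l)))) ⟩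
    ∑ (vectors (vectors bits n) n) (λ g → ∏ (λ k → ∏ (λ l → term k l (lookup (lookup g k) l))))
      ≡⟨ Sum.big-cong (vectors (vectors bits n) n) ∏-term ⟩
    ∑ (vectors (vectors bits n) n) (λ g →
      sign g ℤ.* (∏ (λ k → agreement (lookup g k) (lookup α k) (lookup ρ k))
                  ℤ.* ∏ (λ l → agreement (column g l) (lookup β l) (lookup σ l)))) ∎

∑-permutations : ∀ {n} (s : Subset n) (a : Vec (Fin n) n) → Uniqueᵥ.Unique a →
  ∑ (permutations n) (agreement s a) ≡ + ((n ∸ ∣ s ∣) !)
∑-permutations {n} s a u = trans (∑-filter unique? (vectors (allFin n) n) (agreement s a))
  (completions-! (allFin n) s a (allFin⁺ n) (length-tabulate id) (λ i _ → ∈-allFin (lookup a i))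
    (λ i j _ _ → Uniqueᵥ.lookup-injective u i j))

-- The number of pairs (ρ , σ) of tuples of permutations that agree with a given such pair on the
-- edges of g: one factor for each vertex r_k and each vertex c_l.
weight : ∀ {n} → Graph n → ℤ
weight {n} g = ∏ (λ k → + ((n ∸ ∣ lookup g k ∣) !)) ℤ.* ∏ (λ l → + ((n ∸ ∣ column g l ∣) !))

-- The expansion of the bracket is summed over all (ρ , σ), and the sum over graphs is moved
-- outside. For a fixed graph the remaining double sum splits into a part in ρ and a part in σ.
ξ-sMatrix : ∀ {n} (α β : Table n) → AllUnique α → AllUnique β →
  + ξ n (sMatrix α β) ≡ ∑ (vectors (vectors bits n) n) (λ g → sign g ℤ.* weight g)
ξ-sMatrix {n} α β uα uβ = begin
  + ξ n (sMatrix α β)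
    ≡⟨ +length-filter (disjoint? (sMatrix α β)) (sPermutationMatrices n) ⟩
  ∑ (sPermutationMatrices n) (λ B → ⟦ disjoint? (sMatrix α β) B ⟧)
    ≡⟨ Sum.big-↭ _ (sPermutationMatrices-↭ n) ⟩
  ∑ (cartesianProductWith sMatrix tuples tuples) (λ B → ⟦ disjoint? (sMatrix α β) B ⟧)
    ≡⟨ Sum.big-cartesianProductWith sMatrix tuples tuples _ ⟩
  ∑ tuples (λ ρ → ∑ tuples (λ σ → ⟦ disjoint? (sMatrix α β) (sMatrix ρ σ) ⟧))
    ≡⟨ Sum.big-cong tuples (λ ρ → Sum.big-cong tuples (λ σ → ⟦disjoint⟧ α β ρ σ)) ⟩
  ∑ tuples (λ ρ → ∑ tuples (λ σ → ∑ gs (λ g → sign g ℤ.* (R g ρ ℤ.* C g σ))))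
    ≡⟨ Sum.big-cong tuples (λ ρ → Sum.big-comm tuples gs _) ⟩
  ∑ tuples (λ ρ → ∑ gs (λ g → ∑ tuples (λ σ → sign g ℤ.* (R g ρ ℤ.* C g σ))))
    ≡⟨ Sum.big-comm tuples gs _ ⟩
  ∑ gs (λ g → ∑ tuples (λ ρ → ∑ tuples (λ σ → sign g ℤ.* (R g ρ ℤ.* C g σ))))
    ≡⟨ Sum.big-cong gs factor ⟩
  ∑ gs (λ g → sign g ℤ.* weight g) ∎
  where
  gs = vectors (vectors bits n) n
  tuples = permutationTuples n
  R C : Graph n → Table n → ℤ
  R g ρ = ∏ (λ k → agreement (lookup g k) (lookup α k) (lookup ρ k))
  C g σ = ∏ (λ l → agreement (column g l) (lookup β l) (lookup σ l))
  factor : ∀ g → ∑ tuples (λ ρ → ∑ tuples (λ σ → sign g ℤ.* (R g ρ ℤ.* C g σ))) ≡ sign g ℤ.* weight g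
  factor g = begin
    ∑ tuples (λ ρ → ∑ tuples (λ σ → sign g ℤ.* (R g ρ ℤ.* C g σ)))
      ≡⟨ Sum.big-cong tuples (λ ρ → trans (∑-*ˡ tuples (sign g) (λ σ → R g ρ ℤ.* C g σ))
           (cong (sign g ℤ.*_) (∑-*ˡ tuples (R g ρ) (C g)))) ⟩
    ∑ tuples (λ ρ → sign g ℤ.* (R g ρ ℤ.* ∑ tuples (C g)))
      ≡⟨ trans (∑-*ˡ tuples (sign g) (λ ρ → R g ρ ℤ.* ∑ tuples (C g)))
           (cong (sign g ℤ.*_) (∑-*ʳ tuples (∑ tuples (C g)) (R g))) ⟩
    sign g ℤ.* (∑ tuples (R g) ℤ.* ∑ tuples (C g))
      ≡⟨ cong (sign g ℤ.*_) (cong₂ ℤ._*_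
           -- The entries of a tuple are chosen independently, so the sum over tuples is a product
           -- of sums over single permutations.
           (trans (∑-vectors (permutations n) (λ k → agreement (lookup g k) (lookup α k)))
             (Prod.bigFin-cong (λ k → ∑-permutations (lookup g k) (lookup α k) (uα k))))
           (trans (∑-vectors (permutations n) (λ l → agreement (column g l) (lookup β l)))
             (Prod.bigFin-cong (λ l → ∑-permutations (column g l) (lookup β l) (uβ l))))) ⟩
    sign g ℤ.* weight g ∎

-- Degrees and isomorphism classes

module ℕ-Prod = BigOp ℕ.*-1-isCommutativeMonoid

+∏ : ∀ {n} (f : Fin n → ℕ) → + ℕ-Prod.bigFin f ≡ ∏ (λ i → + f i)
+∏ {zero}  f = refl
+∏ {suc n} f = trans (ℤ.pos-* (f zero) _) (cong (+ f zero ℤ.*_) (+∏ (f ∘ suc)))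

adjacent? : ∀ {n} (g : Graph n) (r c : Fin n) → Dec (lookup (lookup g r) c ≡ true)
adjacent? g r c = lookup (lookup g r) c Bool.≟ true

⟦edge⟧ : ∀ {n} (g : Graph n) r c → ⟦ edge? g (r , c) ⟧ ≡ ⟦ adjacent? g r c ⟧
⟦edge⟧ g r c = ⟦⟧-cong (edge? g (r , c)) (adjacent? g r c) []=⇒lookup (lookup⇒[]= c (lookup g r))

∑-edges : ∀ {n} (g : Graph n) (f : Fin n × Fin n → ℤ) →
  ∑ (edges g) f ≡ ∑ (allFin n) (λ r → ∑ (allFin n) (λ c → ⟦ adjacent? g r c ⟧ ℤ.* f (r , c)))
∑-edges {n} g f = begin
  ∑ (edges g) f
    ≡⟨ ∑-filter (edge? g) (cartesianProduct (allFin n) (allFin n)) f ⟩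
  ∑ (cartesianProduct (allFin n) (allFin n)) (λ e → ⟦ edge? g e ⟧ ℤ.* f e)
    ≡⟨ Sum.big-cartesianProductWith _,_ (allFin n) (allFin n) _ ⟩
  ∑ (allFin n) (λ r → ∑ (allFin n) (λ c → ⟦ edge? g (r , c) ⟧ ℤ.* f (r , c)))
    ≡⟨ Sum.big-cong (allFin n)
         (λ r → Sum.big-cong (allFin n) (λ c → cong (ℤ._* f (r , c)) (⟦edge⟧ g r c))) ⟩
  ∑ (allFin n) (λ r → ∑ (allFin n) (λ c → ⟦ adjacent? g r c ⟧ ℤ.* f (r , c))) ∎

degree-row : ∀ {n} (g : Graph n) k → degree g (inj₁ k) ≡ ∣ lookup g k ∣
degree-row {n} g k = ℤ.+-injective (begin
  + degree g (inj₁ k)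
    ≡⟨ +length-filter (incident? (inj₁ k)) (edges g) ⟩
  ∑ (edges g) (λ e → ⟦ k ≟ proj₁ e ⟧)
    ≡⟨ ∑-edges g (λ e → ⟦ k ≟ proj₁ e ⟧) ⟩
  ∑ (allFin n) (λ r → ∑ (allFin n) (λ c → ⟦ adjacent? g r c ⟧ ℤ.* ⟦ k ≟ r ⟧))
    ≡⟨ Sum.big-cong (allFin n)
         (λ r → trans (∑-*ʳ (allFin n) ⟦ k ≟ r ⟧ (λ c → ⟦ adjacent? g r c ⟧)) (ℤ.*-comm _ ⟦ k ≟ r ⟧)) ⟩
  ∑ (allFin n) (λ r → ⟦ k ≟ r ⟧ ℤ.* ∑ (allFin n) (λ c → ⟦ adjacent? g r c ⟧))
    ≡⟨ ∑-delta (k ≟_) _ (allFin⁺ n) (∈-allFin k) ⟩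
  ∑ (allFin n) (λ c → ⟦ adjacent? g k c ⟧)
    ≡⟨ Sum.big-allFin (λ c → ⟦ adjacent? g k c ⟧) ⟩
  Sum.bigFin (λ c → ⟦ adjacent? g k c ⟧)
    ≡⟨ sym +∣ lookup g k ∣ ⟩
  + ∣ lookup g k ∣ ∎)

lookup-column : ∀ {n} (g : Graph n) r l → lookup (column g l) r ≡ lookup (lookup g r) l
lookup-column g r l = lookup-map r (λ row → lookup row l) g

+∣column∣ : ∀ {n} (g : Graph n) l → + ∣ column g l ∣ ≡ Sum.bigFin (λ r → ⟦ adjacent? g r l ⟧)
+∣column∣ g l = trans +∣ column g l ∣
  (Sum.bigFin-cong (λ r → cong (λ b → ⟦ b Bool.≟ true ⟧) (lookup-column g r l)))

degree-column : ∀ {n} (g : Graph n) l → degree g (inj₂ l) ≡ ∣ column g l ∣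
degree-column {n} g l = ℤ.+-injective (begin
  + degree g (inj₂ l)
    ≡⟨ +length-filter (incident? (inj₂ l)) (edges g) ⟩
  ∑ (edges g) (λ e → ⟦ l ≟ proj₂ e ⟧)
    ≡⟨ ∑-edges g (λ e → ⟦ l ≟ proj₂ e ⟧) ⟩
  ∑ (allFin n) (λ r → ∑ (allFin n) (λ c → ⟦ adjacent? g r c ⟧ ℤ.* ⟦ l ≟ c ⟧))
    ≡⟨ Sum.big-cong (allFin n)
         (λ r → trans (Sum.big-cong (allFin n) (λ c → ℤ.*-comm ⟦ adjacent? g r c ⟧ ⟦ l ≟ c ⟧))
         (∑-delta (l ≟_) (λ c → ⟦ adjacent? g r c ⟧) (allFin⁺ n) (∈-allFin l))) ⟩
  ∑ (allFin n) (λ r → ⟦ adjacent? g r l ⟧)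
    ≡⟨ Sum.big-allFin (λ r → ⟦ adjacent? g r l ⟧) ⟩
  Sum.bigFin (λ r → ⟦ adjacent? g r l ⟧)
    ≡⟨ sym (+∣column∣ g l) ⟩
  + ∣ column g l ∣ ∎)

^-length : {X : Set} (a : ℕ) (xs : List X) → a ^ length xs ≡ ℕ-Prod.big xs (λ _ → a)
^-length a []       = refl
^-length a (x ∷ xs) = cong (a *_) (^-length a xs)

^ℤ-length : {X : Set} (a : ℤ) (xs : List X) → a ℤ.^ length xs ≡ Prod.big xs (λ _ → a)
^ℤ-length a []       = refl
^ℤ-length a (x ∷ xs) = cong (a ℤ.*_) (^ℤ-length a xs)

sign-edges : ∀ {n} (g : Graph n) → sign g ≡ -1ℤ ℤ.^ length (edges g)
sign-edges {n} g = sym (begin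
  -1ℤ ℤ.^ length (edges g)
    ≡⟨ ^ℤ-length -1ℤ (edges g) ⟩
  Prod.big (edges g) (λ _ → -1ℤ)
    ≡⟨ Prod.big-filter (edge? g) (cartesianProduct (allFin n) (allFin n)) (λ _ → -1ℤ) ⟩
  Prod.big (cartesianProduct (allFin n) (allFin n)) (λ e → s (edge? g e))
    ≡⟨ Prod.big-cartesianProductWith _,_ (allFin n) (allFin n) (λ e → s (edge? g e)) ⟩
  Prod.big (allFin n) (λ r → Prod.big (allFin n) (λ c → s (edge? g (r , c))))
    ≡⟨ trans (Prod.big-allFin (λ r → Prod.big (allFin n) (λ c → s (edge? g (r , c)))))
         (Prod.bigFin-cong (λ r → Prod.big-allFin (λ c → s (edge? g (r , c))))) ⟩
  ∏ (λ r → ∏ (λ c → s (edge? g (r , c))))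
    ≡⟨ Prod.bigFin-cong (λ r → Prod.bigFin-cong (λ c → edge-sgn r c (edge? g (r , c)))) ⟩
  sign g ∎)
  where
  s : {P : Set} → Dec P → ℤ
  s d = if does d then -1ℤ else 1ℤ
  edge-sgn : ∀ r c (d : Dec (Edge g (r , c))) → s d ≡ sgn (lookup (lookup g r) c)
  edge-sgn r c (yes e) = cong sgn (sym ([]=⇒lookup e))
  edge-sgn r c (no ¬e) = cong sgn (sym (Bool.¬-not (¬e ∘ lookup⇒[]= c (lookup g r))))

ψ-product : ∀ {n} → Graph n → ℕ
ψ-product {n} g = product (map (λ i → ((n ∸ i) !) ^ ψ i g) (upTo (n ∸ 1)))

-- The factors a (d x) are grouped by the value i of d x. After exchange of the products, each x
-- keeps the single factor with i = d x. If d x is at least m, it is absent from the range, in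
-- accordance with a (d x) = 1.
∏-by-value : {X : Set} (m : ℕ) (a : ℕ → ℕ) (d : X → ℕ) (xs : List X) → (∀ i → m ≤ i → a i ≡ 1) →
  ℕ-Prod.big (upTo m) (λ i → a i ^ length (filter (λ x → d x ℕ.≟ i) xs)) ≡ ℕ-Prod.big xs (a ∘ d)
∏-by-value m a d xs trivial = begin
  ℕ-Prod.big (upTo m) (λ i → a i ^ length (filter (λ x → d x ℕ.≟ i) xs))
    ≡⟨ ℕ-Prod.big-cong (upTo m) (λ i → trans (^-length (a i) (filter (λ x → d x ℕ.≟ i) xs))
         (ℕ-Prod.big-filter (λ x → d x ℕ.≟ i) xs (λ _ → a i))) ⟩
  ℕ-Prod.big (upTo m) (λ i → ℕ-Prod.big xs (λ x → f (d x) i (d x ℕ.≟ i)))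
    ≡⟨ ℕ-Prod.big-comm (upTo m) xs (λ i x → f (d x) i (d x ℕ.≟ i)) ⟩
  ℕ-Prod.big xs (λ x → ℕ-Prod.big (upTo m) (λ i → f (d x) i (d x ℕ.≟ i)))
    ≡⟨ ℕ-Prod.big-cong xs (λ x → single (d x)) ⟩
  ℕ-Prod.big xs (a ∘ d) ∎
  where
  f : ∀ j i → Dec (j ≡ i) → ℕ
  f j i e = if does e then a i else 1
  f-yes : ∀ j (e : Dec (j ≡ j)) → f j j e ≡ a j
  f-yes j (yes _) = refl
  f-yes j (no ¬e) = contradiction refl ¬e
  f-no : ∀ {j i} → j ≢ i → (e : Dec (j ≡ i)) → f j i e ≡ 1
  f-no ¬e (yes e) = contradiction e ¬e
  f-no ¬e (no _)  = refl
  single : ∀ j → ℕ-Prod.big (upTo m) (λ i → f j i (j ℕ.≟ i)) ≡ a j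
  single j with j ℕ.<? m
  ... | yes j<m = trans (ℕ-Prod.big-only (upTo⁺ m) (∈-upTo⁺ j<m) (λ {i} _ j≢i → f-no j≢i (j ℕ.≟ i)))
    (f-yes j (j ℕ.≟ j))
  ... | no j≮m  = trans (ℕ-Prod.big-ε (upTo m)
    (λ {i} i∈ → f-no (λ { refl → j≮m (∈-upTo⁻ i∈) }) (j ℕ.≟ i)))
                    (sym (trivial j (ℕ.≮⇒≥ j≮m)))

-- The range of the product ends at n - 2; from degree n - 1 on the factors are 0! or 1!, since n ∸
-- 1 ≤ i gives n ∸ i ≤ 1.
ψ-product-vertices : ∀ {n} (g : Graph n) → ψ-product g
  ≡ ℕ-Prod.big (vertices n) (λ v → (n ∸ degree g v) !)
ψ-product-vertices {n} g = ∏-by-value (n ∸ 1) (λ i → (n ∸ i) !) (degree g) (vertices n) λ i n∸1≤i →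
  small (ℕ.m≤n+o⇒m∸n≤o n i (ℕ.≤-trans (ℕ.m≤n+m∸n n 1)
    (ℕ.≤-trans (s≤s n∸1≤i) (ℕ.≤-reflexive (ℕ.+-comm 1 i)))))
  where
  small : ∀ {m} → m ≤ 1 → m ! ≡ 1
  small z≤n       = refl
  small (s≤s z≤n) = refl

+ψ-product : ∀ {n} (g : Graph n) → + ψ-product g ≡ weight g
+ψ-product {n} g = begin
  + ψ-product g
    ≡⟨ cong +_ (ψ-product-vertices g) ⟩
  + ℕ-Prod.big (vertices n) w
    ≡⟨ cong +_ (trans (ℕ-Prod.big-++ (map inj₁ (allFin n)) (map inj₂ (allFin n)) w)
         (cong₂ _*_ (trans (ℕ-Prod.big-map inj₁ (allFin n) w) (ℕ-Prod.big-allFin (w ∘ inj₁)))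
                    (trans (ℕ-Prod.big-map inj₂ (allFin n) w) (ℕ-Prod.big-allFin (w ∘ inj₂))))) ⟩
  + (ℕ-Prod.bigFin (w ∘ inj₁) * ℕ-Prod.bigFin (w ∘ inj₂))
    ≡⟨ trans (ℤ.pos-* (ℕ-Prod.bigFin (w ∘ inj₁)) _) (cong₂ ℤ._*_ (+∏ (w ∘ inj₁)) (+∏ (w ∘ inj₂))) ⟩
  ∏ (λ k → + w (inj₁ k)) ℤ.* ∏ (λ l → + w (inj₂ l))
    ≡⟨ cong₂ ℤ._*_ (Prod.bigFin-cong (λ k → cong (λ d → + ((n ∸ d) !)) (degree-row g k)))
                   (Prod.bigFin-cong (λ l → cong (λ d → + ((n ∸ d) !)) (degree-column g l))) ⟩
  weight g ∎
  where
  w : Vertex n → ℕ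
  w v = (n ∸ degree g v) !

≅-refl : ∀ {n} {g : Graph n} → g ≅ g
≅-refl = Perm.id , Perm.id , λ r c → mk⇔ id id

≅-sym : ∀ {n} {g h : Graph n} → g ≅ h → h ≅ g
≅-sym {g = g} {h} (ρ , σ , e) = Perm.flip ρ , Perm.flip σ , λ r c → mk⇔
  (λ edge → backward (e (ρ ⟨$⟩ˡ r) (σ ⟨$⟩ˡ c)) (subst (Edge h) (sym (round r c)) edge))
  (λ edge → subst (Edge h) (round r c) (forward (e (ρ ⟨$⟩ˡ r) (σ ⟨$⟩ˡ c)) edge))
  where
  round : ∀ r c → (ρ ⟨$⟩ʳ (ρ ⟨$⟩ˡ r) , σ ⟨$⟩ʳ (σ ⟨$⟩ˡ c)) ≡ (r , c)
  round r c = cong₂ _,_ (inverseʳ ρ) (inverseʳ σ)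

≅-trans : ∀ {n} {f g h : Graph n} → f ≅ g → g ≅ h → f ≅ h
≅-trans (ρ , σ , e) (ρ′ , σ′ , e′) = ρ Perm.∘ₚ ρ′ , σ Perm.∘ₚ σ′ , λ r c → mk⇔
  (forward (e′ _ _) ∘ forward (e r c)) (backward (e r c) ∘ backward (e′ _ _))

-- Row k of g and row ρ(k) of h have the same size because σ matches their entries, and likewise for
-- columns with the roles exchanged. What remains is a permutation of the factors by ρ and by σ.
weight-resp : ∀ {n} {g h : Graph n} → g ≅ h → weight g ≡ weight h
weight-resp {n} {g} {h} (ρ , σ , e) = cong₂ ℤ._*_
  (trans (Prod.bigFin-cong (λ k → cong (λ d → + ((n ∸ d) !)) (rows k))) (sym (Prod.bigFin-permute _ ρ)))
  (trans (Prod.bigFin-cong (λ l → cong (λ d → + ((n ∸ d) !)) (columns l)))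
    (sym (Prod.bigFin-permute _ σ)))
  where
  preserves : ∀ r c → ⟦ adjacent? g r c ⟧ ≡ ⟦ adjacent? h (ρ ⟨$⟩ʳ r) (σ ⟨$⟩ʳ c) ⟧
  preserves r c = ⟦⟧-cong (adjacent? g r c) (adjacent? h (ρ ⟨$⟩ʳ r) (σ ⟨$⟩ʳ c))
    ([]=⇒lookup ∘ forward (e r c) ∘ lookup⇒[]= c (lookup g r))
    ([]=⇒lookup ∘ backward (e r c) ∘ lookup⇒[]= (σ ⟨$⟩ʳ c) (lookup h (ρ ⟨$⟩ʳ r)))
  rows : ∀ k → ∣ lookup g k ∣ ≡ ∣ lookup h (ρ ⟨$⟩ʳ k) ∣
  rows k = ℤ.+-injective (begin
    + ∣ lookup g k ∣                                              ≡⟨ +∣ lookup g k ∣ ⟩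
    Sum.bigFin (λ c → ⟦ adjacent? g k c ⟧)                        ≡⟨ Sum.bigFin-cong (preserves k) ⟩
    Sum.bigFin (λ c → ⟦ adjacent? h (ρ ⟨$⟩ʳ k) (σ ⟨$⟩ʳ c) ⟧)      ≡⟨ sym
      (Sum.bigFin-permute (λ c → ⟦ adjacent? h (ρ ⟨$⟩ʳ k) c ⟧) σ) ⟩
    Sum.bigFin (λ c → ⟦ adjacent? h (ρ ⟨$⟩ʳ k) c ⟧)               ≡⟨ sym +∣ lookup h (ρ ⟨$⟩ʳ k) ∣ ⟩
    + ∣ lookup h (ρ ⟨$⟩ʳ k) ∣                                     ∎)
  columns : ∀ l → ∣ column g l ∣ ≡ ∣ column h (σ ⟨$⟩ʳ l) ∣
  columns l = ℤ.+-injective (begin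
    + ∣ column g l ∣                                              ≡⟨ +∣column∣ g l ⟩
    Sum.bigFin (λ r → ⟦ adjacent? g r l ⟧)                        ≡⟨ Sum.bigFin-cong
      (λ r → preserves r l) ⟩
    Sum.bigFin (λ r → ⟦ adjacent? h (ρ ⟨$⟩ʳ r) (σ ⟨$⟩ʳ l) ⟧)      ≡⟨ sym
      (Sum.bigFin-permute (λ r → ⟦ adjacent? h r (σ ⟨$⟩ʳ l) ⟧) ρ) ⟩
    Sum.bigFin (λ r → ⟦ adjacent? h r (σ ⟨$⟩ʳ l) ⟧)               ≡⟨ sym (+∣column∣ h (σ ⟨$⟩ʳ l)) ⟩
    + ∣ column h (σ ⟨$⟩ʳ l) ∣                                     ∎)

-- The sum over classes and the leading term

∑-graphs : ∀ n k → ∑ (graphs n k) weight ≡ + classSum n k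
∑-graphs n k = begin
  ∑ (graphs n k) weight
    ≡⟨ ∑-deduplicate _≅?_ (λ {g} → ≅-refl {g = g}) (λ {g} {h} → ≅-sym {g = g} {h})
         (λ {f} {g} {h} → ≅-trans {f = f} {g} {h}) (graphs n k) weight
           (λ {g} {h} → weight-resp {g = g} {h}) ⟩
  ∑ (classes n k) (λ g → + length (isoClass k g) ℤ.* weight g)
    ≡⟨ Sum.big-cong (classes n k)
         (λ g → trans (cong (+ length (isoClass k g) ℤ.*_) (sym (+ψ-product g)))
         (sym (ℤ.pos-* (length (isoClass k g)) (ψ-product g)))) ⟩
  ∑ (classes n k) (λ g → + classTerm n k g)
    ≡⟨ sym (+sum (classes n k) (classTerm n k)) ⟩
  + classSum n k ∎

∑-signed-graphs : ∀ n k → ∑ (graphs n k) (λ g → sign g ℤ.* weight g) ≡ (-1ℤ ℤ.^ k) ℤ.* + classSum n k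
∑-signed-graphs n k = begin
  ∑ (graphs n k) (λ g → sign g ℤ.* weight g)
    ≡⟨ Sum.big-cong-∈ (graphs n k) (λ {g} g∈ → cong (ℤ._* weight g) (trans (sign-edges g)
         (cong (-1ℤ ℤ.^_) (proj₂ (∈-filter⁻
           (λ h → length (edges h) ℕ.≟ k) {xs = vectors (vectors bits n) n} g∈))))) ⟩
  ∑ (graphs n k) (λ g → (-1ℤ ℤ.^ k) ℤ.* weight g)
    ≡⟨ ∑-*ˡ (graphs n k) (-1ℤ ℤ.^ k) weight ⟩
  (-1ℤ ℤ.^ k) ℤ.* ∑ (graphs n k) weight
    ≡⟨ cong ((-1ℤ ℤ.^ k) ℤ.*_) (∑-graphs n k) ⟩
  (-1ℤ ℤ.^ k) ℤ.* + classSum n k ∎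

length-cartesianProductWith : {X Y Z : Set} (f : X → Y → Z) (xs : List X) (ys : List Y) →
  length (cartesianProductWith f xs ys) ≡ length xs * length ys
length-cartesianProductWith f []       ys = refl
length-cartesianProductWith f (x ∷ xs) ys = trans (length-++ (map (f x) ys))
  (cong₂ ℕ._+_ (length-map (f x) ys) (length-cartesianProductWith f xs ys))

length-edges : ∀ {n} (g : Graph n) → length (edges g) ≤ n * n
length-edges {n} g = ℕ.≤-trans (length-filter (edge? g) (cartesianProduct (allFin n) (allFin n)))
  (ℕ.≤-reflexive (trans (length-cartesianProductWith _,_ (allFin n) (allFin n))
    (cong₂ _*_ (length-tabulate {n = n} id) (length-tabulate {n = n} id))))

noEdges : ∀ n → Graph n
noEdges n = replicate n (replicate n false)

edgeless : ∀ {n} {g : Graph n} → length (edges g) ≡ 0 → noEdges n ≡ g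
edgeless {n} {g} none = lookup-ext λ r → trans (lookup-replicate r _) (lookup-ext λ c →
  trans (lookup-replicate c false) (sym (Bool.¬-not (λ adj → absent
    (∈-filter⁺ (edge? g) (∈-cartesianProduct⁺ (∈-allFin r) (∈-allFin c))
      (lookup⇒[]= c (lookup g r) adj)) none))))
  where
  absent : {X : Set} {x : X} {xs : List X} → x ∈ xs → length xs ≢ 0
  absent {xs = _ ∷ _} _ ()

edges-noEdges : ∀ n → length (edges (noEdges n)) ≡ 0
edges-noEdges n = cong length
  (filter-none (edge? (noEdges n)) {xs = cartesianProduct (allFin n) (allFin n)}
  (All.tabulate (λ {(r , c)} _ e → absurd r c ([]=⇒lookup e))))
  where
  absurd : ∀ r c → lookup (lookup (noEdges n) r) c ≢ true
  absurd r c eq with () ← trans (sym eq)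
    (trans (cong (λ s → lookup s c) (lookup-replicate r (replicate n false)))
      (lookup-replicate c false))

weight-noEdges : ∀ n → weight (noEdges n) ≡ + ((n !) ^ (2 * n))
weight-noEdges n = begin
  weight (noEdges n)
    ≡⟨ sym (+ψ-product (noEdges n)) ⟩
  + ψ-product (noEdges n)
    ≡⟨ cong +_ (trans (ψ-product-vertices (noEdges n))
         (ℕ-Prod.big-cong (vertices n) (λ v → cong (λ d → (n ∸ d) !) (isolated v)))) ⟩
  + ℕ-Prod.big (vertices n) (λ _ → n !)
    ≡⟨ cong +_ (sym (^-length (n !) (vertices n))) ⟩
  + ((n !) ^ length (vertices n))
    ≡⟨ cong (λ m → + ((n !) ^ m)) length-vertices ⟩
  + ((n !) ^ (2 * n)) ∎
  where
  isolated : ∀ v → degree (noEdges n) v ≡ 0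
  isolated v = ℕ.n≤0⇒n≡0 (ℕ.≤-trans (length-filter (incident? v) (edges (noEdges n)))
    (ℕ.≤-reflexive (edges-noEdges n)))
  length-vertices : length (vertices n) ≡ 2 * n
  length-vertices = trans (length-++ (map inj₁ (allFin n))) (cong₂ ℕ._+_
    (trans (length-map inj₁ (allFin n)) (length-tabulate {n = n} id))
    (trans (trans (length-map inj₂ (allFin n)) (length-tabulate {n = n} id)) (sym (ℕ.+-identityʳ n))))

-- The only graph without edges has sign 1, and each of its 2n vertices has degree 0 and contributes
-- n!.
∑-graphs-0 : ∀ n → ∑ (graphs n 0) (λ g → sign g ℤ.* weight g) ≡ + ((n !) ^ (2 * n))
∑-graphs-0 n = begin
  ∑ (graphs n 0) (λ g → sign g ℤ.* weight g)
    ≡⟨ Sum.big-only (filter⁺ empty? (vectors⁺ (vectors⁺ bits-unique n) n))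
         (∈-filter⁺ empty? (∈-vectors⁺ (noEdges n) (λ r → ∈-vectors⁺ _ (λ c → ∈-bits _)))
           (edges-noEdges n))
         (λ {g} g∈ ≢g → contradiction
           (edgeless (proj₂ (∈-filter⁻ empty? {xs = vectors (vectors bits n) n} g∈))) ≢g) ⟩
  sign (noEdges n) ℤ.* weight (noEdges n)
    ≡⟨ cong₂ ℤ._*_ (trans (sign-edges (noEdges n)) (cong (-1ℤ ℤ.^_) (edges-noEdges n)))
         (weight-noEdges n) ⟩
  1ℤ ℤ.* + ((n !) ^ (2 * n))
    ≡⟨ ℤ.*-identityˡ _ ⟩
  + ((n !) ^ (2 * n)) ∎
  where
  empty? : Decidable (λ (g : Graph n) → length (edges g) ≡ 0)
  empty? g = length (edges g) ℕ.≟ 0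

theorem2 : (n : ℕ) .{{_ : NonZero n}} (A : BinaryMatrix (n * n) (n * n)) → IsSPermutation n A →
    + ξ n A ≡ + ((n !) ^ (2 * n)) ℤ.+ sumℤ (map (λ k → (-1ℤ ℤ.^ k) ℤ.* + classSum n k) (map suc (upTo (n * n))))
theorem2 n A s = begin
  + ξ n A
    ≡⟨ cong (λ B → + ξ n B) (≡-sMatrix s) ⟩
  + ξ n (sMatrix (blockRows s) (blockColumns s))
    ≡⟨ ξ-sMatrix (blockRows s) (blockColumns s) (blockRows-unique s) (blockColumns-unique s) ⟩
  ∑ (vectors (vectors bits n) n) signed
    -- The number of edges lies among the n² + 1 values 0, ..., n².
    ≡⟨ ∑-fibres (vectors (vectors bits n) n) (length ∘ edges) (suc (n * n)) signed
         (s≤s ∘ length-edges) ⟩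
  ∑ (upTo (suc (n * n))) (λ k → ∑ (graphs n k) signed)
    -- The range begins with 0 by computation, which splits off the leading term; its tail is
    -- rewritten to the 1, ..., n² of the formula.
    ≡⟨ cong (λ ks → ∑ (0 ∷ ks) (λ k → ∑ (graphs n k) signed)) (sym (map-upTo suc (n * n))) ⟩
  ∑ (graphs n 0) signed ℤ.+ ∑ (map suc (upTo (n * n))) (λ k → ∑ (graphs n k) signed)
    ≡⟨ cong₂ ℤ._+_ (∑-graphs-0 n) (Sum.big-cong (map suc (upTo (n * n))) (∑-signed-graphs n)) ⟩
  + ((n !) ^ (2 * n)) ℤ.+ sumℤ (map (λ k → (-1ℤ ℤ.^ k) ℤ.* + classSum n k) (map suc (upTo (n * n)))) ∎
  where
  signed : Graph n → ℤ
  signed g = sign g ℤ.* weight g
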